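{- Let $\Sigma$ be a finite set of node labels and $\bot\notin\Sigma$. Let $f\in\mathcal{F}_0(\Sigma)$ be a forest and let $F$ be an FSLP (or TSLP) over $\Sigma\uplus\{\bot\}$ with $[\![F]\!]=\mathrm{fcns}(f)$. Then one can transform $F$ in linear time into an FSLP $F'$ over $\Sigma$ with $[\![F']\!]=f$ and $|F'|\in O(|F|)$.
   Context: **Trees and forests.** $\mathcal{F}_0(\Sigma)$ is the set of finite ordered $\Sigma$-labelled forests (possibly empty sequences of trees) and $\mathcal{T}_0(\Sigma)$ the set of ordered unranked $\Sigma$-labelled trees. Inductively: a sequence $t_1\cdots t_n$ ($n\ge 0$) of trees is a forest ($\varepsilon$ is the empty one), and $a(f)$ is a tree for $a\in\Sigma$ and $f$ a forest; $a()$ is also written $a$. Fix a parameter $x\notin\Sigma$. $\mathcal{F}_1(\Sigma)$ is the set of forests over $\Sigma\cup\{x\}$ in which $x$ occurs exactly once, at a leaf. $\mathcal{F}(\Sigma)=\mathcal{F}_0(\Sigma)\cup\mathcal{F}_1(\Sigma)$. **fcns-encoding.** $\mathrm{fcns}:\mathcal{F}_0(\Sigma)\to\mathcal{T}_0(\Sigma\uplus\{\bot\})$ is given by $\mathrm{fcns}(\varepsilon)=\bot$ and $\mathrm{fcns}(a(f)g)=a(\mathrm{fcns}(f)\,\mathrm{fcns}(g))$ for $a\in\Sigma$, $f,g\in\mathcal{F}_0(\Sigma)$. **FSLPs.** The forest algebra on $\mathcal{F}(\Sigma)$ has operations: horizontal concatenation $fg$ (defined if at least one of $f,g$ is in $\mathcal{F}_0(\Sigma)$);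 vertical concatenation $f\langle g\rangle$ (defined if $f\in\mathcal{F}_1(\Sigma)$; replace $x$ in $f$ by $g$); the unary operations $f\mapsto a(f)$, $a\in\Sigma$; the constants $\varepsilon$ and $x$. An FSLP over $\Sigma$ is $F=(V,S,\rho)$ with $V$ a finite set of variables, $S\in V$ the start variable, and $\rho$ mapping each $A\in V$ to its right-hand side, an expression over these operations in which variables from $V$ may occur as atoms, such that the relation "$B$ occurs in $\rho(A)$" is acyclic, all values $[\![A]\!]_F$ (obtained by evaluating $\rho(A)$ recursively) are defined, and $[\![F]\!]:=[\![S]\!]_F\in\mathcal{F}_0(\Sigma)$. The size $|F|$ is the total number of occurrences of operations (including constants) in all right-hand sides (this is the number of variables if every right-hand side is a single operation applied to variables). A TSLP is an FSLP in which every right-hand side has the form $a$, $a(BC)$, $a(xB)$, $a(Bx)$, or $B\langle C\rangle$ with $a$ a label and $B,C$ variables. -}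

module Defs where

open import Data.Fin using (Fin; toℕ)
open import Data.Fin.Properties using () renaming (_≟_ to _≟ᶠ_)
open import Data.List using (List; []; _∷_; _++_; sum; tabulate; foldr)
open import Data.List.Membership.Propositional using (_∈_)
open import Data.Maybe using (Maybe; just; nothing; maybe)
open import Data.Nat using (ℕ; suc; _+_)
open import Data.Nat.Properties using () renaming (_≟_ to _≟ⁿ_)
open import Data.Product using (Σ; ∃-syntax; proj₁)
open import Data.Sum using (_⊎_; inj₁; inj₂; [_,_]′)
open import Data.Vec using (Vec; []; _∷_; lookup)
open import Function using (id; _∘_)
open import Relation.Binary.Construct.Closure.Transitive using (TransClosure)
open import Relation.Binary.PropositionalEquality using (_≡_)
open import Relation.Nullary using (¬_; yes; no)

------------------------------------------------------------------------
-- Trees, forests, and forests with one occurrence of the parameter x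

data Tree (L : Set) : Set where
  node : L → List (Tree L) → Tree L

𝓕₀ : Set → Set
𝓕₀ L = List (Tree L)

-- hole l r is the forest l x r; down l a c r is the forest l a(c) r.
data 𝓕₁ (L : Set) : Set where
  hole : 𝓕₀ L → 𝓕₀ L → 𝓕₁ L
  down : 𝓕₀ L → L → 𝓕₁ L → 𝓕₀ L → 𝓕₁ L

𝓕 : Set → Set
𝓕 L = 𝓕₀ L ⊎ 𝓕₁ L

-- The adjoined label ⊥ is nothing.
_⊎⊥ : Set → Set
L ⊎⊥ = Maybe L

fcns : {L : Set} → 𝓕₀ L → Tree (L ⊎⊥)
fcns []             = node nothing []
fcns (node a f ∷ g) = node (just a) (fcns f ∷ fcns g ∷ [])

------------------------------------------------------------------------
-- The forest algebra

module _ {L : Set} where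

  flank : 𝓕₀ L → 𝓕 L → 𝓕₀ L → 𝓕 L
  flank l (inj₁ f)               r = inj₁ (l ++ f ++ r)
  flank l (inj₂ (hole l′ r′))     r = inj₂ (hole (l ++ l′) (r′ ++ r))
  flank l (inj₂ (down l′ a c r′)) r = inj₂ (down (l ++ l′) a c (r′ ++ r))

  root : L → 𝓕 L → 𝓕 L
  root a (inj₁ f) = inj₁ (node a f ∷ [])
  root a (inj₂ c) = inj₂ (down [] a c [])

  plug : 𝓕₁ L → 𝓕 L → 𝓕 L
  plug (hole l r)     g = flank l g r
  plug (down l a c r) g = flank l (root a (plug c g)) r

  -- The partial operations return nothing where they are undefined.
  hconcat : 𝓕 L → 𝓕 L → Maybe (𝓕 L)
  hconcat (inj₁ f) g        = just (flank f g [])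
  hconcat (inj₂ c) (inj₁ g) = just (flank [] (inj₂ c) g)
  hconcat (inj₂ _) (inj₂ _) = nothing

  vconcat : 𝓕 L → 𝓕 L → Maybe (𝓕 L)
  vconcat (inj₁ _) _ = nothing
  vconcat (inj₂ c) g = just (plug c g)

------------------------------------------------------------------------
-- FSLPs and TSLPs

infixr 7 _∙_
infix  8 _⟨_⟩

data Expr (L V : Set) : Set where
  ε     : Expr L V
  x     : Expr L V
  _∙_   : Expr L V → Expr L V → Expr L V
  _⟨_⟩  : Expr L V → Expr L V → Expr L V
  op    : L → Expr L V → Expr L V
  var   : V → Expr L V

module _ {L V : Set} where

  variables : Expr L V → List V
  variables ε           = []
  variables x           = []
  variables (e₁ ∙ e₂)   = variables e₁ ++ variables e₂
  variables (e₁ ⟨ e₂ ⟩) = variables e₁ ++ variables e₂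
  variables (op _ e)    = variables e
  variables (var A)     = A ∷ []

  -- Variables are not operations and contribute nothing.
  operations : Expr L V → ℕ
  operations ε           = 1
  operations x           = 1
  operations (e₁ ∙ e₂)   = suc (operations e₁ + operations e₂)
  operations (e₁ ⟨ e₂ ⟩) = suc (operations e₁ + operations e₂)
  operations (op _ e)    = suc (operations e)
  operations (var _)     = 0

  infix 4 _⊢_⇓_

  data _⊢_⇓_ (ρ : V → Expr L V) : Expr L V → 𝓕 L → Set where
    ε    : ρ ⊢ ε ⇓ inj₁ []
    x    : ρ ⊢ x ⇓ inj₂ (hole [] [])
    _∙_  : ∀ {e₁ e₂ v₁ v₂ v} → ρ ⊢ e₁ ⇓ v₁ → ρ ⊢ e₂ ⇓ v₂ →
           hconcat v₁ v₂ ≡ just v → ρ ⊢ e₁ ∙ e₂ ⇓ v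
    _⟨_⟩ : ∀ {e₁ e₂ v₁ v₂ v} → ρ ⊢ e₁ ⇓ v₁ → ρ ⊢ e₂ ⇓ v₂ →
           vconcat v₁ v₂ ≡ just v → ρ ⊢ e₁ ⟨ e₂ ⟩ ⇓ v
    op   : ∀ {a e v} → ρ ⊢ e ⇓ v → ρ ⊢ op a e ⇓ root a v
    var  : ∀ {A v} → ρ ⊢ ρ A ⇓ v → ρ ⊢ var A ⇓ v

record FSLP (L : Set) : Set where
  field
    ∣V∣   : ℕ
    start : Fin ∣V∣
    ρ     : Fin ∣V∣ → Expr L (Fin ∣V∣)

  _occursIn_ : Fin ∣V∣ → Fin ∣V∣ → Set
  B occursIn A = B ∈ variables (ρ A)

  field
    acyclic : ∀ A → ¬ TransClosure _occursIn_ A A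
    defined : ∀ A → ∃[ v ] ρ ⊢ var A ⇓ v
    ground  : ∃[ f ] ρ ⊢ var start ⇓ inj₁ f

  ⟦_⟧ : 𝓕₀ L
  ⟦_⟧ = proj₁ ground

  size : ℕ
  size = sum (tabulate (operations ∘ ρ))

open FSLP public using (∣V∣; ⟦_⟧; size)

data TSLPForm {L V : Set} : Expr L V → Set where
  leaf  : ∀ {a}     → TSLPForm (op a ε)
  inner : ∀ {a B C} → TSLPForm (op a (var B ∙ var C))
  holeˡ : ∀ {a B}   → TSLPForm (op a (x ∙ var B))
  holeʳ : ∀ {a B}   → TSLPForm (op a (var B ∙ x))
  subst : ∀ {B C}   → TSLPForm (var B ⟨ var C ⟩)

TSLP : Set → Set
TSLP L = Σ (FSLP L) λ F → ∀ A → TSLPForm (FSLP.ρ F A)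

asFSLP : {L : Set} → FSLP L ⊎ TSLP L → FSLP L
asFSLP = [ id , proj₁ ]′

------------------------------------------------------------------------
-- Machine model: a unit-cost pointer machine, presented as a first-order
-- language with recursive procedures. A value is a number or a pointer to
-- an immutable pair; the memory consists of finitely many mutable arrays.
-- Every evaluation step costs one unit. The only arithmetic is successor
-- and predecessor, so a number grows by at most one per step. A program is
-- a finite piece of syntax, hence each step takes constant time on a
-- random-access machine.

data Val : Set where
  num  : ℕ → Val
  pair : Val → Val → Val

-- n is the number of local variables (de Bruijn indices) in scope.
data Term (procs arrays n : ℕ) : Set where
  var    : Fin n → Term procs arrays n
  lit    : ℕ → Term procs arrays n
  succ   : Term procs arrays n → Term procs arrays n
  ifzero : Term procs arrays n → Term procs arrays n →
           Term procs arrays (suc n) → Term procs arrays n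
  cons   : Term procs arrays n → Term procs arrays n → Term procs arrays n
  split  : Term procs arrays n → Term procs arrays (suc (suc n)) →
           Term procs arrays n
  bind   : Term procs arrays n → Term procs arrays (suc n) →
           Term procs arrays n
  call   : Fin procs → Term procs arrays n → Term procs arrays n
  get    : Fin arrays → Term procs arrays n → Term procs arrays n
  set    : Fin arrays → Term procs arrays n → Term procs arrays n →
           Term procs arrays n

record Program : Set where
  field
    procs  : ℕ
    arrays : ℕ
    body   : Fin procs → Term procs arrays 1
    main   : Term procs arrays 1

Memory : ℕ → Set
Memory arrays = Fin arrays → ℕ → Val

blank : ∀ {k} → Memory k
blank _ _ = num 0

store : ∀ {k} → Memory k → Fin k → ℕ → Val → Memory k
store μ a i v b j with b ≟ᶠ a | j ≟ⁿ i
... | yes _ | yes _ = v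
... | _     | _     = μ b j

module Semantics (P : Program) where
  open Program P

  -- Eval γ s μ v μ′ t: in environment γ, the term s takes memory μ to μ′,
  -- returns v, and uses t steps.
  data Eval {n} (γ : Vec Val n) :
       Term procs arrays n → Memory arrays → Val → Memory arrays → ℕ → Set where
    var   : ∀ {i μ} → Eval γ (var i) μ (lookup γ i) μ 1
    lit   : ∀ {k μ} → Eval γ (lit k) μ (num k) μ 1
    succ  : ∀ {s k μ μ₁ t} → Eval γ s μ (num k) μ₁ t →
            Eval γ (succ s) μ (num (suc k)) μ₁ (suc t)
    zeroᵇ : ∀ {s s₀ s₁ v μ μ₁ μ₂ t t₁} →
            Eval γ s μ (num 0) μ₁ t → Eval γ s₀ μ₁ v μ₂ t₁ →
            Eval γ (ifzero s s₀ s₁) μ v μ₂ (suc (t + t₁))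
    sucᵇ  : ∀ {s s₀ s₁ k v μ μ₁ μ₂ t t₁} →
            Eval γ s μ (num (suc k)) μ₁ t → Eval (num k ∷ γ) s₁ μ₁ v μ₂ t₁ →
            Eval γ (ifzero s s₀ s₁) μ v μ₂ (suc (t + t₁))
    cons  : ∀ {s s₁ u v μ μ₁ μ₂ t t₁} →
            Eval γ s μ u μ₁ t → Eval γ s₁ μ₁ v μ₂ t₁ →
            Eval γ (cons s s₁) μ (pair u v) μ₂ (suc (t + t₁))
    split : ∀ {s s₁ u w v μ μ₁ μ₂ t t₁} →
            Eval γ s μ (pair u w) μ₁ t → Eval (u ∷ w ∷ γ) s₁ μ₁ v μ₂ t₁ →
            Eval γ (split s s₁) μ v μ₂ (suc (t + t₁))
    bind  : ∀ {s s₁ u v μ μ₁ μ₂ t t₁} →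
            Eval γ s μ u μ₁ t → Eval (u ∷ γ) s₁ μ₁ v μ₂ t₁ →
            Eval γ (bind s s₁) μ v μ₂ (suc (t + t₁))
    call  : ∀ {f s u v μ μ₁ μ₂ t t₁} →
            Eval γ s μ u μ₁ t → Eval (u ∷ []) (body f) μ₁ v μ₂ t₁ →
            Eval γ (call f s) μ v μ₂ (suc (t + t₁))
    get   : ∀ {a s k μ μ₁ t} → Eval γ s μ (num k) μ₁ t →
            Eval γ (get a s) μ (μ₁ a k) μ₁ (suc t)
    set   : ∀ {a s s₁ k v μ μ₁ μ₂ t t₁} →
            Eval γ s μ (num k) μ₁ t → Eval γ s₁ μ₁ v μ₂ t₁ →
            Eval γ (set a s s₁) μ v (store μ₂ a k v) (suc (t + t₁))

-- P transforms u into v in exactly t steps.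
_runs_↦_in-steps_ : Program → Val → Val → ℕ → Set
P runs u ↦ v in-steps t = ∃[ μ ] Eval (u ∷ []) (Program.main P) blank v μ t
  where open Semantics P

------------------------------------------------------------------------
-- FSLPs as machine values

module _ {L : Set} (label : L → ℕ) where

  encodeExpr : ∀ {n} → Expr L (Fin n) → Val
  encodeExpr ε           = pair (num 0) (num 0)
  encodeExpr x           = pair (num 1) (num 0)
  encodeExpr (e₁ ∙ e₂)   = pair (num 2) (pair (encodeExpr e₁) (encodeExpr e₂))
  encodeExpr (e₁ ⟨ e₂ ⟩) = pair (num 3) (pair (encodeExpr e₁) (encodeExpr e₂))
  encodeExpr (op a e)    = pair (num 4) (pair (num (label a)) (encodeExpr e))
  encodeExpr (var A)     = pair (num 5) (num (toℕ A))

  encode : FSLP L → Val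
  encode F = pair (num (∣V∣ F)) (pair (num (toℕ (FSLP.start F)))
               (foldr pair (num 0) (tabulate (encodeExpr ∘ FSLP.ρ F))))

label : ∀ {σ} → Fin σ → ℕ
label = toℕ

label⊥ : ∀ {σ} → Fin σ ⊎⊥ → ℕ
label⊥ = maybe (suc ∘ toℕ) 0

-- The number of nodes of encode F is linear in this quantity. The summand
-- ∣V∣ matters only for right-hand sides that are a single variable, which
-- occupy space but contain no operation.
inputLength : {L : Set} → FSLP L → ℕ
inputLength F = ∣V∣ F + size F

-- Decoding a(t u) as a(decode t) decode u and ⊥ as ε inverts fcns, and it sends
-- a binary context to a forest context, so that it commutes with substitution.
-- The subexpressions of an FSLP for fcns f need not denote trees or contexts
-- with the parameter in the place of a tree: since every inner node of fcns f
-- has two children, they denote sequences of at most two trees, one of which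
-- may be a context whose parameter awaits zero, one or two trees. There are
-- finitely many shapes of such sequences, each with at most two forests or
-- contexts over Σ as contents, and the shape and the contents of an operation
-- are determined by those of its operands at the cost of boundedly many
-- operations. Hence every variable A is replaced by two variables for the
-- contents of its value. Values that occur in no fcns f have the shape junk,
-- which is absorbing, so they do not contribute to the start variable.
--
-- The machine computes shapes by a memoised recursion on the variables; the
-- budget of a right-hand side is spent when its variable is first visited.

module Submission where

open import Defs
open import Data.Bool using (Bool; true; false; if_then_else_)
open import Data.Empty using (⊥; ⊥-elim)
open import Data.Fin using (Fin; zero; suc; toℕ; #_)
open import Data.Fin.Patterns using (0F; 1F; 2F; 3F; 4F; 5F; 6F; 7F; 8F; 9F)
open import Data.Fin.Properties using (toℕ-injective; toℕ<n; _≟_)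
open import Data.List using (List; []; _∷_; _++_; tabulate; foldr)
open import Data.List.Membership.Propositional using (_∈_)
open import Data.List.Membership.Propositional.Properties using (∈-++⁺ˡ; ∈-++⁺ʳ)
open import Data.List.Properties using (++-assoc; ++-identityʳ; tabulate-cong)
open import Data.List.Relation.Binary.Pointwise as Pointwise using (Pointwise; []; _∷_)
open import Data.List.Relation.Unary.All as All using (All; []; _∷_)
import Data.List.Relation.Unary.All.Properties as All
open import Data.List.Relation.Unary.Any using (here)
open import Data.Maybe as Maybe using (Maybe; just; nothing)
import Data.Maybe.Relation.Binary.Pointwise as MP
open import Data.Maybe.Relation.Binary.Pointwise using (just; nothing)
open import Data.Nat using (ℕ; suc; zero; _+_; _*_; _≤_; _<_; z≤n; s≤s)
open import Data.Nat.ListAction using (sum)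
open import Data.Nat.Properties hiding (_≟_)
import Data.Nat.Properties as ℕ
open import Data.Nat.Tactic.RingSolver using (solve-∀)
open import Data.Product using (_×_; _,_; proj₁; proj₂; ∃-syntax; Σ-syntax)
open import Data.Sum using (_⊎_; inj₁; inj₂; reduce)
open import Data.Unit using (⊤)
open import Data.Vec as Vec using (Vec; []; _∷_; lookup)
import Data.Vec.Relation.Binary.Pointwise.Inductive as VP
open import Data.Vec.Relation.Binary.Pointwise.Inductive using ([]; _∷_)
open import Data.Vec.Relation.Unary.All using ([]; _∷_)
import Data.Vec.Relation.Unary.All.Properties as VA
open import Function using (_∘_; id)
open import Relation.Binary.Construct.Closure.Transitive using (TransClosure; [_]; _∷_)
open import Relation.Binary.PropositionalEquality hiding ([_]; subst; inspect)
import Relation.Binary.PropositionalEquality as ≡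
open import Relation.Nullary using (yes; no; does)

-- Plugging into `a(x)` is the obstacle: the trees to come decide both the forest below the new node
-- and the forest to its right, so the decoded node cannot be prepared in advance. Hence its label
-- is kept with the shape, the node is made once its children are known, and the stored context only
-- reserves a place for it. The shape of a variable is read off its semantic value, so the
-- translation needs no recursion along the order of the variables. Correctness goes by induction on
-- evaluation derivations, and the machine, which sees only the grammar, is shown to find the same
-- shapes. Acyclicity enters where cycles of the new grammar are excluded and where a variable must
-- not be marked during its own translation. Sequences that are too broad can be given up at once:
-- concatenation adds breadths and filling never lowers the breadth of an item, so nothing later
-- repairs them. The size stays linear because every rule uses each content of its operands at most
-- once.

-- The parameter of the forest algebra is gap. In ctx nothing k the parameter
-- awaits one tree; in ctx (just a) k it awaits the two children of a node a,
-- and the parameter of k stands for that node. A context whose parameter awaits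
-- no tree is not distinguished from a tree.
data Item (L A B : Set) : Set where
  tree : A → Item L A B
  gap  : Item L A B
  ctx  : Maybe L → B → Item L A B
  bad  : Item L A B

Word : Set → Set → Set → Set
Word L A B = List (Item L A B)

-- T, X and C stand for tree, gap and ctx.
data Form (L A B : Set) : Set where
  ∅           : Form L A B
  T           : A → Form L A B
  TT          : A → A → Form L A B
  X           : Form L A B
  XT TX       : A → Form L A B
  XTT TXT TTX : A → A → Form L A B
  C           : Maybe L → B → Form L A B
  CT          : Maybe L → B → A → Form L A B
  TC          : A → Maybe L → B → Form L A B
  junk        : Form L A B

-- Normal forms of words of items

module _ {L A B : Set} where

  push : Item L A B → Form L A B → Form L A B
  push (tree f)  ∅        = T f
  push (tree f)  (T g)    = TT f g
  push (tree f)  X        = TX f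
  push (tree f)  (XT g)   = TXT f g
  push (tree f)  (TX g)   = TTX f g
  push (tree f)  (C j k)  = TC f j k
  push gap       ∅        = X
  push gap       (T f)    = XT f
  push gap       (TT f g) = XTT f g
  push (ctx j k) ∅        = C j k
  push (ctx j k) (T f)    = CT j k f
  push _         _        = junk

  normal : Word L A B → Form L A B
  normal []      = ∅
  normal (i ∷ u) = push i (normal u)

  word : Form L A B → Word L A B
  word ∅          = []
  word (T f)      = tree f ∷ []
  word (TT f g)   = tree f ∷ tree g ∷ []
  word X          = gap ∷ []
  word (XT f)     = gap ∷ tree f ∷ []
  word (TX f)     = tree f ∷ gap ∷ []
  word (XTT f g)  = gap ∷ tree f ∷ tree g ∷ []
  word (TXT f g)  = tree f ∷ gap ∷ tree g ∷ []
  word (TTX f g)  = tree f ∷ tree g ∷ gap ∷ []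
  word (C j k)    = ctx j k ∷ []
  word (CT j k f) = ctx j k ∷ tree f ∷ []
  word (TC f j k) = tree f ∷ ctx j k ∷ []
  word junk       = bad ∷ []

  -- The weight 3 makes every word that contains bad too broad.
  breadth : Word L A B → ℕ
  breadth []            = 0
  breadth (tree _ ∷ u)  = 1 + breadth u
  breadth (gap ∷ u)     = breadth u
  breadth (ctx _ _ ∷ u) = 1 + breadth u
  breadth (bad ∷ u)     = 3 + breadth u

  marks : Word L A B → ℕ
  marks []            = 0
  marks (tree _ ∷ u)  = marks u
  marks (gap ∷ u)     = 1 + marks u
  marks (ctx _ _ ∷ u) = 1 + marks u
  marks (bad ∷ u)     = marks u

  breadth-++ : ∀ u v → breadth (u ++ v) ≡ breadth u + breadth v
  breadth-++ []            v = refl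
  breadth-++ (tree _ ∷ u)  v = cong suc (breadth-++ u v)
  breadth-++ (gap ∷ u)     v = breadth-++ u v
  breadth-++ (ctx _ _ ∷ u) v = cong suc (breadth-++ u v)
  breadth-++ (bad ∷ u)     v = cong (3 +_) (breadth-++ u v)

  marks-++ : ∀ u v → marks (u ++ v) ≡ marks u + marks v
  marks-++ []            v = refl
  marks-++ (tree _ ∷ u)  v = marks-++ u v
  marks-++ (gap ∷ u)     v = cong suc (marks-++ u v)
  marks-++ (ctx _ _ ∷ u) v = cong suc (marks-++ u v)
  marks-++ (bad ∷ u)     v = marks-++ u v

  -- Two marks never come from a value, where the parameter occurs at most once. Words are treated
  -- without this invariant, so every failure of `push` needs a reason that longer words inherit.
  Invalid : Word L A B → Set
  Invalid u = 3 ≤ breadth u ⊎ 2 ≤ marks u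

  invalid-++ʳ : ∀ u v → Invalid v → Invalid (u ++ v)
  invalid-++ʳ u v (inj₁ p) = inj₁ (≤-trans p (≤-trans (m≤n+m _ (breadth u)) (≤-reflexive (sym (breadth-++ u v)))))
  invalid-++ʳ u v (inj₂ p) = inj₂ (≤-trans p (≤-trans (m≤n+m _ (marks u)) (≤-reflexive (sym (marks-++ u v)))))

  invalid-++ˡ : ∀ u v → Invalid u → Invalid (u ++ v)
  invalid-++ˡ u v (inj₁ p) = inj₁ (≤-trans p (≤-trans (m≤m+n _ (breadth v)) (≤-reflexive (sym (breadth-++ u v)))))
  invalid-++ˡ u v (inj₂ p) = inj₂ (≤-trans p (≤-trans (m≤m+n _ (marks v)) (≤-reflexive (sym (marks-++ u v)))))

  private
    pattern kept = inj₁ refl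
    pattern too-wide = inj₂ (refl , inj₁ (s≤s (s≤s (s≤s z≤n))))
    pattern twice-marked = inj₂ (refl , inj₂ (s≤s (s≤s z≤n)))

  push-exact : ∀ i s → word (push i s) ≡ i ∷ word s ⊎ (push i s ≡ junk × Invalid (i ∷ word s))
  push-exact (tree f)  ∅           = kept
  push-exact (tree f)  (T _)       = kept
  push-exact (tree f)  (TT _ _)    = too-wide
  push-exact (tree f)  X           = kept
  push-exact (tree f)  (XT _)      = kept
  push-exact (tree f)  (TX _)      = kept
  push-exact (tree f)  (XTT _ _)   = too-wide
  push-exact (tree f)  (TXT _ _)   = too-wide
  push-exact (tree f)  (TTX _ _)   = too-wide
  push-exact (tree f)  (C _ _)     = kept
  push-exact (tree f)  (CT _ _ _)  = too-wide
  push-exact (tree f)  (TC _ _ _)  = too-wide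
  push-exact (tree f)  junk        = too-wide
  push-exact gap       ∅           = kept
  push-exact gap       (T _)       = kept
  push-exact gap       (TT _ _)    = kept
  push-exact gap       X           = twice-marked
  push-exact gap       (XT _)      = twice-marked
  push-exact gap       (TX _)      = twice-marked
  push-exact gap       (XTT _ _)   = twice-marked
  push-exact gap       (TXT _ _)   = twice-marked
  push-exact gap       (TTX _ _)   = twice-marked
  push-exact gap       (C _ _)     = twice-marked
  push-exact gap       (CT _ _ _)  = twice-marked
  push-exact gap       (TC _ _ _)  = twice-marked
  push-exact gap       junk        = too-wide
  push-exact (ctx _ _) ∅           = kept
  push-exact (ctx _ _) (T _)       = kept
  push-exact (ctx _ _) (TT _ _)    = too-wide
  push-exact (ctx _ _) X           = twice-marked
  push-exact (ctx _ _) (XT _)      = twice-marked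
  push-exact (ctx _ _) (TX _)      = twice-marked
  push-exact (ctx _ _) (XTT _ _)   = twice-marked
  push-exact (ctx _ _) (TXT _ _)   = twice-marked
  push-exact (ctx _ _) (TTX _ _)   = twice-marked
  push-exact (ctx _ _) (C _ _)     = twice-marked
  push-exact (ctx _ _) (CT _ _ _)  = twice-marked
  push-exact (ctx _ _) (TC _ _ _)  = twice-marked
  push-exact (ctx _ _) junk        = too-wide
  push-exact bad       s           = inj₂ (refl , inj₁ (s≤s (s≤s (s≤s z≤n))))

  push-junk : ∀ i → push i junk ≡ junk
  push-junk (tree _)  = refl
  push-junk gap       = refl
  push-junk (ctx _ _) = refl
  push-junk bad       = refl

  -- Information is lost only on words all of whose extensions are invalid too; this is what lets
  -- `normal` respect concatenation.
  normal-exact : ∀ u → word (normal u) ≡ u ⊎ (normal u ≡ junk × Invalid u)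
  normal-exact []      = inj₁ refl
  normal-exact (i ∷ u) with normal-exact u
  ... | inj₁ e       = ≡.subst (λ v → word (push i (normal u)) ≡ i ∷ v ⊎ (push i (normal u) ≡ junk × Invalid (i ∷ v)))
                             e (push-exact i (normal u))
  ... | inj₂ (e , p) = inj₂ (trans (cong (push i) e) (push-junk i) , invalid-++ʳ (i ∷ []) u p)

  normal-word : ∀ s → normal (word s) ≡ s
  normal-word ∅          = refl
  normal-word (T _)      = refl
  normal-word (TT _ _)   = refl
  normal-word X          = refl
  normal-word (XT _)     = refl
  normal-word (TX _)     = refl
  normal-word (XTT _ _)  = refl
  normal-word (TXT _ _)  = refl
  normal-word (TTX _ _)  = refl
  normal-word (C _ _)    = refl
  normal-word (CT _ _ _) = refl
  normal-word (TC _ _ _) = refl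
  normal-word junk       = refl

  invalid-word : ∀ s → Invalid (word s) → s ≡ junk
  invalid-word ∅          (inj₁ ())
  invalid-word ∅          (inj₂ ())
  invalid-word (T _)      (inj₁ (s≤s ()))
  invalid-word (T _)      (inj₂ ())
  invalid-word (TT _ _)   (inj₁ (s≤s (s≤s ())))
  invalid-word (TT _ _)   (inj₂ ())
  invalid-word X          (inj₁ ())
  invalid-word X          (inj₂ (s≤s ()))
  invalid-word (XT _)     (inj₁ (s≤s ()))
  invalid-word (XT _)     (inj₂ (s≤s ()))
  invalid-word (TX _)     (inj₁ (s≤s ()))
  invalid-word (TX _)     (inj₂ (s≤s ()))
  invalid-word (XTT _ _)  (inj₁ (s≤s (s≤s ())))
  invalid-word (XTT _ _)  (inj₂ (s≤s ()))
  invalid-word (TXT _ _)  (inj₁ (s≤s (s≤s ())))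
  invalid-word (TXT _ _)  (inj₂ (s≤s ()))
  invalid-word (TTX _ _)  (inj₁ (s≤s (s≤s ())))
  invalid-word (TTX _ _)  (inj₂ (s≤s ()))
  invalid-word (C _ _)    (inj₁ (s≤s ()))
  invalid-word (C _ _)    (inj₂ (s≤s ()))
  invalid-word (CT _ _ _) (inj₁ (s≤s (s≤s ())))
  invalid-word (CT _ _ _) (inj₂ (s≤s ()))
  invalid-word (TC _ _ _) (inj₁ (s≤s (s≤s ())))
  invalid-word (TC _ _ _) (inj₂ (s≤s ()))
  invalid-word junk       _ = refl

  normal-invalid : ∀ {u} → Invalid u → normal u ≡ junk
  normal-invalid {u} p with normal-exact u
  ... | inj₁ e       = invalid-word (normal u) (≡.subst Invalid (sym e) p)
  ... | inj₂ (e , _) = e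

  normal-wide : ∀ {u} → 3 ≤ breadth u → normal u ≡ junk
  normal-wide {u} p = normal-invalid {u} (inj₁ p)

  infixr 5 _⊙_
  _⊙_ : Form L A B → Form L A B → Form L A B
  s ⊙ t = normal (word s ++ word t)

  -- If both factors are kept, the two sides normalise the same word. Otherwise the concatenation
  -- inherits the invalidity of a factor, and both sides are `junk`.
  normal-++ : ∀ u v → normal (u ++ v) ≡ normal u ⊙ normal v
  normal-++ u v with normal-exact u | normal-exact v
  ... | inj₁ e       | inj₁ e′       = sym (cong normal (cong₂ _++_ e e′))
  ... | inj₂ (e , p) | _             = trans (normal-invalid {u ++ v} (invalid-++ˡ u v p))
                                             (sym (trans (cong (_⊙ normal v) e) refl))
  ... | inj₁ _       | inj₂ (e , p)  = trans (normal-invalid {u ++ v} (invalid-++ʳ u v p))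
    (sym (trans (cong (normal u ⊙_) e)
      (normal-invalid {word (normal u) ++ bad ∷ []} (invalid-++ʳ (word (normal u)) _ (inj₁ (s≤s (s≤s (s≤s z≤n))))))))

  normal-mid : ∀ u {v v′} r → normal v ≡ normal v′ → normal (u ++ v ++ r) ≡ normal (u ++ v′ ++ r)
  normal-mid u {v} {v′} r e = trans (normal-++ u (v ++ r)) (trans
    (cong (normal u ⊙_) (trans (normal-++ v r) (trans (cong (_⊙ normal r) e) (sym (normal-++ v′ r)))))
    (sym (normal-++ u (v′ ++ r))))

-- Operations on forms over an abstract algebra

-- A and B are the sorts of forests and of contexts; tt a f g, ct a k g and
-- tc a f k are a(f)g, a(k)g and a(f)k.
record Alg (L : Set) : Set₁ where
  field
    A B  : Set
    emp  : A
    tt   : L → A → A → A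
    □    : B
    ct   : L → B → A → B
    tc   : L → A → B → B
    sub₀ : B → A → A
    sub₁ : B → B → B

record Split (L A B : Set) : Set where
  constructor split
  field
    before : Word L A B
    mark   : Item L A B
    after  : Word L A B

open Split public

-- Without a marked item, the parameter can only be hidden in a tree, where it awaits nothing; the
-- first tree is taken for its place.
locate : ∀ {L A B} → Form L A B → Split L A B
locate (T f)      = split [] (tree f) []
locate (TT f g)   = split [] (tree f) (tree g ∷ [])
locate X          = split [] gap []
locate (XT f)     = split [] gap (tree f ∷ [])
locate (TX f)     = split (tree f ∷ []) gap []
locate (XTT f g)  = split [] gap (tree f ∷ tree g ∷ [])
locate (TXT f g)  = split (tree f ∷ []) gap (tree g ∷ [])
locate (TTX f g)  = split (tree f ∷ tree g ∷ []) gap []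
locate (C j k)    = split [] (ctx j k) []
locate (CT j k f) = split [] (ctx j k) (tree f ∷ [])
locate (TC f j k) = split (tree f ∷ []) (ctx j k) []
locate _          = split [] bad []

guard : ∀ {L A B} → Form L A B → Item L A B → Item L A B
guard ∅ i = i
guard X i = i
guard _ i = bad

module Ops {L : Set} (𝒜 : Alg L) where
  open Alg 𝒜

  I = Item L A B
  W = Word L A B
  F = Form L A B

  -- In `a(x)` the parameter has to bring both children, in `XT` and `TX` the missing one. In `XTT`,
  -- `TXT` and `TTX` both are present, so the parameter may only vanish and the node counts as a
  -- tree. In `T` and `C` a child is missing that nothing can supply any more.
  build : Maybe L → F → I
  build nothing  s          = guard s (tree emp)
  build (just a) (TT f g)   = tree (tt a f g)
  build (just a) X          = ctx (just a) □
  build (just a) (XT f)     = ctx nothing (ct a □ f)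
  build (just a) (TX f)     = ctx nothing (tc a f □)
  build (just a) (XTT f g)  = tree (tt a f g)
  build (just a) (TXT f g)  = tree (tt a f g)
  build (just a) (TTX f g)  = tree (tt a f g)
  build (just a) (CT j k f) = ctx j (ct a k f)
  build (just a) (TC f j k) = ctx j (tc a f k)
  build (just a) _          = bad

  -- In `XT` and `TX` the one awaited tree is there already, so the parameter beside it may only
  -- vanish.
  single : F → I
  single (T f)   = tree f
  single X       = ctx nothing □
  single (XT f)  = tree f
  single (TX f)  = tree f
  single (C j k) = ctx j k
  single _       = bad

  demand : Maybe L → F → I
  demand nothing  s = single s
  demand (just a) s = build (just a) s

  attach : B → I → I
  attach k (tree f)   = tree (sub₀ k f)
  attach k (ctx j k′) = ctx j (sub₁ k k′)
  attach k _          = bad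

  fill : I → F → W
  fill gap       s = word s
  fill (tree f)  s = guard s (tree f) ∷ []
  fill (ctx j k) s = attach k (demand j s) ∷ []
  fill bad       s = bad ∷ []

  vertical : F → F → F
  vertical s t = normal (before (locate s) ++ fill (mark (locate s)) t ++ after (locate s))

-- Parametricity of the operations on forms

module Relations {L L′ A A′ B B′ : Set}
                 (RL : L → L′ → Set) (RA : A → A′ → Set) (RB : B → B′ → Set) where

  data ItemRel : Item L A B → Item L′ A′ B′ → Set where
    tree : ∀ {f f′} → RA f f′ → ItemRel (tree f) (tree f′)
    gap  : ItemRel gap gap
    ctx  : ∀ {j j′ k k′} → MP.Pointwise RL j j′ → RB k k′ → ItemRel (ctx j k) (ctx j′ k′)
    bad  : ItemRel bad bad

  data FormRel : Form L A B → Form L′ A′ B′ → Set where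
    ∅    : FormRel ∅ ∅
    T    : ∀ {f f′} → RA f f′ → FormRel (T f) (T f′)
    TT   : ∀ {f f′ g g′} → RA f f′ → RA g g′ → FormRel (TT f g) (TT f′ g′)
    X    : FormRel X X
    XT   : ∀ {f f′} → RA f f′ → FormRel (XT f) (XT f′)
    TX   : ∀ {f f′} → RA f f′ → FormRel (TX f) (TX f′)
    XTT  : ∀ {f f′ g g′} → RA f f′ → RA g g′ → FormRel (XTT f g) (XTT f′ g′)
    TXT  : ∀ {f f′ g g′} → RA f f′ → RA g g′ → FormRel (TXT f g) (TXT f′ g′)
    TTX  : ∀ {f f′ g g′} → RA f f′ → RA g g′ → FormRel (TTX f g) (TTX f′ g′)
    C    : ∀ {j j′ k k′} → MP.Pointwise RL j j′ → RB k k′ → FormRel (C j k) (C j′ k′)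
    CT   : ∀ {j j′ k k′ f f′} → MP.Pointwise RL j j′ → RB k k′ → RA f f′ →
           FormRel (CT j k f) (CT j′ k′ f′)
    TC   : ∀ {j j′ k k′ f f′} → RA f f′ → MP.Pointwise RL j j′ → RB k k′ →
           FormRel (TC f j k) (TC f′ j′ k′)
    junk : FormRel junk junk

  WordRel : Word L A B → Word L′ A′ B′ → Set
  WordRel = Pointwise ItemRel

  word-rel : ∀ {s s′} → FormRel s s′ → WordRel (word s) (word s′)
  word-rel ∅          = []
  word-rel (T p)      = tree p ∷ []
  word-rel (TT p q)   = tree p ∷ tree q ∷ []
  word-rel X          = gap ∷ []
  word-rel (XT p)     = gap ∷ tree p ∷ []
  word-rel (TX p)     = tree p ∷ gap ∷ []
  word-rel (XTT p q)  = gap ∷ tree p ∷ tree q ∷ []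
  word-rel (TXT p q)  = tree p ∷ gap ∷ tree q ∷ []
  word-rel (TTX p q)  = tree p ∷ tree q ∷ gap ∷ []
  word-rel (C p q)    = ctx p q ∷ []
  word-rel (CT p q r) = ctx p q ∷ tree r ∷ []
  word-rel (TC p q r) = tree p ∷ ctx q r ∷ []
  word-rel junk       = bad ∷ []

  push-rel : ∀ {i i′ s s′} → ItemRel i i′ → FormRel s s′ → FormRel (push i s) (push i′ s′)
  push-rel (tree p)  ∅          = T p
  push-rel (tree p)  (T q)      = TT p q
  push-rel (tree p)  (TT _ _)   = junk
  push-rel (tree p)  X          = TX p
  push-rel (tree p)  (XT q)     = TXT p q
  push-rel (tree p)  (TX q)     = TTX p q
  push-rel (tree p)  (XTT _ _)  = junk
  push-rel (tree p)  (TXT _ _)  = junk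
  push-rel (tree p)  (TTX _ _)  = junk
  push-rel (tree p)  (C q r)    = TC p q r
  push-rel (tree p)  (CT _ _ _) = junk
  push-rel (tree p)  (TC _ _ _) = junk
  push-rel (tree p)  junk       = junk
  push-rel gap       ∅          = X
  push-rel gap       (T p)      = XT p
  push-rel gap       (TT p q)   = XTT p q
  push-rel gap       X          = junk
  push-rel gap       (XT _)     = junk
  push-rel gap       (TX _)     = junk
  push-rel gap       (XTT _ _)  = junk
  push-rel gap       (TXT _ _)  = junk
  push-rel gap       (TTX _ _)  = junk
  push-rel gap       (C _ _)    = junk
  push-rel gap       (CT _ _ _) = junk
  push-rel gap       (TC _ _ _) = junk
  push-rel gap       junk       = junk
  push-rel (ctx p q) ∅          = C p q
  push-rel (ctx p q) (T r)      = CT p q r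
  push-rel (ctx _ _) (TT _ _)   = junk
  push-rel (ctx _ _) X          = junk
  push-rel (ctx _ _) (XT _)     = junk
  push-rel (ctx _ _) (TX _)     = junk
  push-rel (ctx _ _) (XTT _ _)  = junk
  push-rel (ctx _ _) (TXT _ _)  = junk
  push-rel (ctx _ _) (TTX _ _)  = junk
  push-rel (ctx _ _) (C _ _)    = junk
  push-rel (ctx _ _) (CT _ _ _) = junk
  push-rel (ctx _ _) (TC _ _ _) = junk
  push-rel (ctx _ _) junk       = junk
  push-rel bad       _          = junk

  normal-rel : ∀ {u u′} → WordRel u u′ → FormRel (normal u) (normal u′)
  normal-rel []       = ∅
  normal-rel (p ∷ ps) = push-rel p (normal-rel ps)

  ⊙-rel : ∀ {s s′ t t′} → FormRel s s′ → FormRel t t′ → FormRel (s ⊙ t) (s′ ⊙ t′)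
  ⊙-rel p q = normal-rel (Pointwise.++⁺ (word-rel p) (word-rel q))

  guard-rel : ∀ {s s′ i i′} → FormRel s s′ → ItemRel i i′ → ItemRel (guard s i) (guard s′ i′)
  guard-rel ∅          p = p
  guard-rel (T _)      p = bad
  guard-rel (TT _ _)   p = bad
  guard-rel X          p = p
  guard-rel (XT _)     p = bad
  guard-rel (TX _)     p = bad
  guard-rel (XTT _ _)  p = bad
  guard-rel (TXT _ _)  p = bad
  guard-rel (TTX _ _)  p = bad
  guard-rel (C _ _)    p = bad
  guard-rel (CT _ _ _) p = bad
  guard-rel (TC _ _ _) p = bad
  guard-rel junk       p = bad

  SplitRel : Split L A B → Split L′ A′ B′ → Set
  SplitRel s s′ = WordRel (before s) (before s′) × ItemRel (mark s) (mark s′) × WordRel (after s) (after s′)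

  locate-rel : ∀ {s s′} → FormRel s s′ → SplitRel (locate s) (locate s′)
  locate-rel ∅          = [] , bad , []
  locate-rel (T p)      = [] , tree p , []
  locate-rel (TT p q)   = [] , tree p , tree q ∷ []
  locate-rel X          = [] , gap , []
  locate-rel (XT p)     = [] , gap , tree p ∷ []
  locate-rel (TX p)     = tree p ∷ [] , gap , []
  locate-rel (XTT p q)  = [] , gap , tree p ∷ tree q ∷ []
  locate-rel (TXT p q)  = tree p ∷ [] , gap , tree q ∷ []
  locate-rel (TTX p q)  = tree p ∷ tree q ∷ [] , gap , []
  locate-rel (C p q)    = [] , ctx p q , []
  locate-rel (CT p q r) = [] , ctx p q , tree r ∷ []
  locate-rel (TC p q r) = tree p ∷ [] , ctx q r , []
  locate-rel junk       = [] , bad , []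

-- All rules are polymorphic in the algebra, hence preserve every relation
-- between two algebras. This is used for evaluation, for the variables of an
-- expression, and for the machine terms that build expressions.
record AlgRel {L L′ : Set} (𝒜 : Alg L) (𝒜′ : Alg L′) : Set₁ where
  private
    module 𝒜 = Alg 𝒜
    module 𝒜′ = Alg 𝒜′
  field
    RL : L → L′ → Set
    RA : 𝒜.A → 𝒜′.A → Set
    RB : 𝒜.B → 𝒜′.B → Set
    emp  : RA 𝒜.emp 𝒜′.emp
    tt   : ∀ {a a′ f f′ g g′} → RL a a′ → RA f f′ → RA g g′ → RA (𝒜.tt a f g) (𝒜′.tt a′ f′ g′)
    □    : RB 𝒜.□ 𝒜′.□
    ct   : ∀ {a a′ k k′ g g′} → RL a a′ → RB k k′ → RA g g′ → RB (𝒜.ct a k g) (𝒜′.ct a′ k′ g′)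
    tc   : ∀ {a a′ f f′ k k′} → RL a a′ → RA f f′ → RB k k′ → RB (𝒜.tc a f k) (𝒜′.tc a′ f′ k′)
    sub₀ : ∀ {k k′ g g′} → RB k k′ → RA g g′ → RA (𝒜.sub₀ k g) (𝒜′.sub₀ k′ g′)
    sub₁ : ∀ {k k′ g g′} → RB k k′ → RB g g′ → RB (𝒜.sub₁ k g) (𝒜′.sub₁ k′ g′)

  open Relations RL RA RB public
  private
    module O = Ops 𝒜
    module O′ = Ops 𝒜′

  build-rel : ∀ {a a′ s s′} → MP.Pointwise RL a a′ → FormRel s s′ → ItemRel (O.build a s) (O′.build a′ s′)
  build-rel nothing  p          = guard-rel p (tree emp)
  build-rel (just a) ∅          = bad
  build-rel (just a) (T _)      = bad
  build-rel (just a) (TT p q)   = tree (tt a p q)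
  build-rel (just a) X          = ctx (just a) □
  build-rel (just a) (XT p)     = ctx nothing (ct a □ p)
  build-rel (just a) (TX p)     = ctx nothing (tc a p □)
  build-rel (just a) (XTT p q)  = tree (tt a p q)
  build-rel (just a) (TXT p q)  = tree (tt a p q)
  build-rel (just a) (TTX p q)  = tree (tt a p q)
  build-rel (just a) (C _ _)    = bad
  build-rel (just a) (CT j k p) = ctx j (ct a k p)
  build-rel (just a) (TC p j k) = ctx j (tc a p k)
  build-rel (just a) junk       = bad

  single-rel : ∀ {s s′} → FormRel s s′ → ItemRel (O.single s) (O′.single s′)
  single-rel ∅          = bad
  single-rel (T p)      = tree p
  single-rel (TT _ _)   = bad
  single-rel X          = ctx nothing □
  single-rel (XT p)     = tree p
  single-rel (TX p)     = tree p
  single-rel (XTT _ _)  = bad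
  single-rel (TXT _ _)  = bad
  single-rel (TTX _ _)  = bad
  single-rel (C p q)    = ctx p q
  single-rel (CT _ _ _) = bad
  single-rel (TC _ _ _) = bad
  single-rel junk       = bad

  demand-rel : ∀ {j j′ s s′} → MP.Pointwise RL j j′ → FormRel s s′ → ItemRel (O.demand j s) (O′.demand j′ s′)
  demand-rel nothing  p = single-rel p
  demand-rel (just a) p = build-rel (just a) p

  attach-rel : ∀ {k k′ i i′} → RB k k′ → ItemRel i i′ → ItemRel (O.attach k i) (O′.attach k′ i′)
  attach-rel k (tree p)  = tree (sub₀ k p)
  attach-rel k gap       = bad
  attach-rel k (ctx j p) = ctx j (sub₁ k p)
  attach-rel k bad       = bad

  fill-rel : ∀ {i i′ s s′} → ItemRel i i′ → FormRel s s′ → WordRel (O.fill i s) (O′.fill i′ s′)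
  fill-rel (tree p)  q = guard-rel q (tree p) ∷ []
  fill-rel gap       q = word-rel q
  fill-rel (ctx j k) q = attach-rel k (demand-rel j q) ∷ []
  fill-rel bad       q = bad ∷ []

  vertical-rel : ∀ {s s′ t t′} → FormRel s s′ → FormRel t t′ → FormRel (O.vertical s t) (O′.vertical s′ t′)
  vertical-rel p q with locate-rel p
  ... | l , m , r = normal-rel (Pointwise.++⁺ l (Pointwise.++⁺ (fill-rel m q) r))

-- Decoding of values

module _ {L : Set} where

  plug₀ : 𝓕₁ L → 𝓕₀ L → 𝓕₀ L
  plug₀ (hole l r)     g = l ++ g ++ r
  plug₀ (down l a c r) g = l ++ (node a (plug₀ c g) ∷ []) ++ r

  plug₁ : 𝓕₁ L → 𝓕₁ L → 𝓕₁ L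
  plug₁ (hole l r)     (hole l′ r′)     = hole (l ++ l′) (r′ ++ r)
  plug₁ (hole l r)     (down l′ a c r′) = down (l ++ l′) a c (r′ ++ r)
  -- `l ++ []` is the form in which `plug` leaves the left siblings; it makes `plug-inj₂` a plain
  -- congruence here.
  plug₁ (down l a c r) c′               = down (l ++ []) a (plug₁ c c′) r

  plug-inj₁ : ∀ c g → plug c (inj₁ g) ≡ inj₁ (plug₀ c g)
  plug-inj₁ (hole l r)     g = refl
  plug-inj₁ (down l a c r) g = cong (λ v → flank l (root a v) r) (plug-inj₁ c g)

  plug-inj₂ : ∀ c c′ → plug c (inj₂ c′) ≡ inj₂ (plug₁ c c′)
  plug-inj₂ (hole l r)     (hole _ _)     = refl
  plug-inj₂ (hole l r)     (down _ _ _ _) = refl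
  plug-inj₂ (down l a c r) c′             = cong (λ v → flank l (root a v) r) (plug-inj₂ c c′)

  precede : L → 𝓕₀ L → 𝓕₁ L → 𝓕₁ L
  precede a f (hole l r)     = hole (node a f ∷ l) r
  precede a f (down l b c r) = down (node a f ∷ l) b c r

  forests : Alg L
  forests = record
    { A    = 𝓕₀ L
    ; B    = 𝓕₁ L
    ; emp  = []
    ; tt   = λ a f g → node a f ∷ g
    ; □    = hole [] []
    ; ct   = λ a k g → down [] a k g
    ; tc   = precede
    ; sub₀ = plug₀
    ; sub₁ = plug₁
    }

  plug₀-precede : ∀ a f k g → plug₀ (precede a f k) g ≡ node a f ∷ plug₀ k g
  plug₀-precede a f (hole _ _)     g = refl
  plug₀-precede a f (down _ _ _ _) g = refl

  plug₁-precede : ∀ a f k k′ → plug₁ (precede a f k) k′ ≡ precede a f (plug₁ k k′)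
  plug₁-precede a f (hole _ _)     (hole _ _)     = refl
  plug₁-precede a f (hole _ _)     (down _ _ _ _) = refl
  plug₁-precede a f (down _ _ _ _) k′             = refl

  plug₁-□ : ∀ k → plug₁ k (hole [] []) ≡ k
  plug₁-□ (hole l r)     = cong (λ l → hole l r) (++-identityʳ l)
  plug₁-□ (down l a c r) = cong₂ (λ l c → down l a c r) (++-identityʳ l) (plug₁-□ c)

  □-plug₁ : ∀ k → plug₁ (hole [] []) k ≡ k
  □-plug₁ (hole l r)     = cong (hole l) (++-identityʳ r)
  □-plug₁ (down l a c r) = cong (down l a c) (++-identityʳ r)

  open Ops forests public

  -- Filling the parameter below one node

  build-wide : ∀ a {u} → 3 ≤ breadth u → build a (normal u) ≡ bad
  build-wide nothing  {u} p rewrite normal-wide {u = u} p = refl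
  build-wide (just _) {u} p rewrite normal-wide {u = u} p = refl

  -- Only ∅ and X fill a context whose parameter awaits no tree.
  vacuous : ∀ (s : F) → s ≡ ∅ ⊎ s ≡ X ⊎ 1 ≤ breadth (word s)
  vacuous ∅          = inj₁ refl
  vacuous (T _)      = inj₂ (inj₂ (s≤s z≤n))
  vacuous (TT _ _)   = inj₂ (inj₂ (s≤s z≤n))
  vacuous X          = inj₂ (inj₁ refl)
  vacuous (XT _)     = inj₂ (inj₂ (s≤s z≤n))
  vacuous (TX _)     = inj₂ (inj₂ (s≤s z≤n))
  vacuous (XTT _ _)  = inj₂ (inj₂ (s≤s z≤n))
  vacuous (TXT _ _)  = inj₂ (inj₂ (s≤s z≤n))
  vacuous (TTX _ _)  = inj₂ (inj₂ (s≤s z≤n))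
  vacuous (C _ _)    = inj₂ (inj₂ (s≤s z≤n))
  vacuous (CT _ _ _) = inj₂ (inj₂ (s≤s z≤n))
  vacuous (TC _ _ _) = inj₂ (inj₂ (s≤s z≤n))
  vacuous junk       = inj₂ (inj₂ (s≤s z≤n))

  data Solid : I → Set where
    tree : ∀ {f} → Solid (tree f)
    ctx  : ∀ {j k} → Solid (ctx j k)
    bad  : Solid bad

  guard-solid : ∀ s {i} → Solid i → Solid (guard s i)
  guard-solid ∅          p = p
  guard-solid X          p = p
  guard-solid (T _)      p = bad
  guard-solid (TT _ _)   p = bad
  guard-solid (XT _)     p = bad
  guard-solid (TX _)     p = bad
  guard-solid (XTT _ _)  p = bad
  guard-solid (TXT _ _)  p = bad
  guard-solid (TTX _ _)  p = bad
  guard-solid (C _ _)    p = bad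
  guard-solid (CT _ _ _) p = bad
  guard-solid (TC _ _ _) p = bad
  guard-solid junk       p = bad

  attach-solid : ∀ k i → Solid (attach k i)
  attach-solid k (tree _)  = tree
  attach-solid k gap       = bad
  attach-solid k (ctx _ _) = ctx
  attach-solid k bad       = bad

  solid-breadth : ∀ {i} → Solid i → 1 ≤ breadth (i ∷ [])
  solid-breadth tree = s≤s z≤n
  solid-breadth ctx  = s≤s z≤n
  solid-breadth bad  = s≤s z≤n

  -- A filled tree or context remains a solid item, `bad` remains `bad`, and a gap counts nothing to
  -- begin with.
  fill-breadth : ∀ m (t : F) → breadth (m ∷ []) ≤ breadth (fill m t)
  fill-breadth (tree f)  t = solid-breadth (guard-solid t tree)
  fill-breadth gap       t = z≤n
  fill-breadth (ctx j k) t = solid-breadth (attach-solid k (demand j t))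
  fill-breadth bad       t = ≤-refl

  -- The items to which forests without parameter decode.
  data Plain : I → Set where
    tree : ∀ {f} → Plain (tree f)
    bad  : Plain bad

  -- The siblings of the marked item contain no parameter, so there are six arrangements of breadth
  -- at most two. In every other one the word is `junk`, whatever the marked item is.
  data Sides : W → W → Set where
    none      : Sides [] []
    right     : ∀ {f} → Sides [] (tree f ∷ [])
    left      : ∀ {f} → Sides (tree f ∷ []) []
    two-right : ∀ {f g} → Sides [] (tree f ∷ tree g ∷ [])
    both      : ∀ {f g} → Sides (tree f ∷ []) (tree g ∷ [])
    two-left  : ∀ {f g} → Sides (tree f ∷ tree g ∷ []) []
    wide      : ∀ {l r} → 3 ≤ breadth l + breadth r → Sides l r

  sides : ∀ {l r} → All Plain l → All Plain r → Sides l r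
  sides []                      []                      = none
  sides []                      (tree ∷ [])             = right
  sides []                      (tree ∷ tree ∷ [])      = two-right
  sides []                      (tree ∷ tree ∷ tree ∷ _) = wide (s≤s (s≤s (s≤s z≤n)))
  sides []                      (tree ∷ tree ∷ bad ∷ _) = wide (s≤s (s≤s (s≤s z≤n)))
  sides []                      (tree ∷ bad ∷ _)        = wide (s≤s (s≤s (s≤s z≤n)))
  sides []                      (bad ∷ _)               = wide (s≤s (s≤s (s≤s z≤n)))
  sides (tree ∷ [])             []                      = left
  sides (tree ∷ [])             (tree ∷ [])             = both
  sides (tree ∷ [])             (tree ∷ tree ∷ _)       = wide (s≤s (s≤s (s≤s z≤n)))
  sides (tree ∷ [])             (tree ∷ bad ∷ _)        = wide (s≤s (s≤s (s≤s z≤n)))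
  sides (tree ∷ [])             (bad ∷ _)               = wide (s≤s (s≤s (s≤s z≤n)))
  sides (tree ∷ tree ∷ [])      []                      = two-left
  sides (tree ∷ tree ∷ [])      (tree ∷ _)              = wide (s≤s (s≤s (s≤s z≤n)))
  sides (tree ∷ tree ∷ [])      (bad ∷ _)               = wide (s≤s (s≤s (s≤s z≤n)))
  sides (tree ∷ tree ∷ tree ∷ _) _                      = wide (s≤s (s≤s (s≤s z≤n)))
  sides (tree ∷ tree ∷ bad ∷ _) _                       = wide (s≤s (s≤s (s≤s z≤n)))
  sides (tree ∷ bad ∷ _)        _                       = wide (s≤s (s≤s (s≤s z≤n)))
  sides (bad ∷ _)               _                       = wide (s≤s (s≤s (s≤s z≤n)))

  breadth-around : ∀ (l v r : W) → breadth l + breadth r + breadth v ≤ breadth (l ++ v ++ r)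
  breadth-around l v r rewrite breadth-++ l (v ++ r) | breadth-++ v r | +-assoc (breadth l) (breadth r) (breadth v) =
    +-monoʳ-≤ (breadth l) (≤-reflexive (+-comm (breadth r) (breadth v)))

  -- Treats the node `a(x)`: its parameter takes both children at once, so filling builds the node
  -- from the filler and attaches it to the trivial context.
  build-□ : ∀ a s → attach (hole [] []) (build (just a) s) ≡ build (just a) s
  build-□ a ∅          = refl
  build-□ a (T _)      = refl
  build-□ a (TT f g)   = cong tree (++-identityʳ _)
  build-□ a X          = refl
  build-□ a (XT f)     = cong (ctx nothing) (□-plug₁ _)
  build-□ a (TX f)     = refl
  build-□ a (XTT f g)  = cong tree (++-identityʳ _)
  build-□ a (TXT f g)  = cong tree (++-identityʳ _)
  build-□ a (TTX f g)  = cong tree (++-identityʳ _)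
  build-□ a (C _ _)    = refl
  build-□ a (CT j k f) = cong (ctx j) (□-plug₁ _)
  build-□ a (TC f j k) = cong (ctx j) (□-plug₁ _)
  build-□ a junk       = refl

  -- Treats the node `a(x u)`: the context `a(x)g` stands ready, and the filler must amount to a
  -- single tree.
  build-XT : ∀ a s g → build (just a) (normal (word s ++ tree g ∷ [])) ≡ attach (down [] a (hole [] []) g) (single s)
  build-XT a ∅          g = refl
  build-XT a (T _)      g = cong (λ f → tree (node a f ∷ g)) (sym (++-identityʳ _))
  build-XT a (TT _ _)   g = refl
  build-XT a X          g = refl
  build-XT a (XT _)     g = cong (λ f → tree (node a f ∷ g)) (sym (++-identityʳ _))
  build-XT a (TX _)     g = cong (λ f → tree (node a f ∷ g)) (sym (++-identityʳ _))
  build-XT a (XTT _ _)  g = refl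
  build-XT a (TXT _ _)  g = refl
  build-XT a (TTX _ _)  g = refl
  build-XT a (C j k)    g = cong (λ k → ctx j (down [] a k g)) (sym (□-plug₁ k))
  build-XT a (CT _ _ _) g = refl
  build-XT a (TC _ _ _) g = refl
  build-XT a junk       g = refl

  build-TX : ∀ a f s → build (just a) (push (tree f) (normal (word s ++ []))) ≡ attach (hole (node a f ∷ []) []) (single s)
  build-TX a f ∅          = refl
  build-TX a f (T _)      = cong (λ g → tree (node a f ∷ g)) (sym (++-identityʳ _))
  build-TX a f (TT _ _)   = refl
  build-TX a f X          = refl
  build-TX a f (XT _)     = cong (λ g → tree (node a f ∷ g)) (sym (++-identityʳ _))
  build-TX a f (TX _)     = cong (λ g → tree (node a f ∷ g)) (sym (++-identityʳ _))
  build-TX a f (XTT _ _)  = refl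
  build-TX a f (TXT _ _)  = refl
  build-TX a f (TTX _ _)  = refl
  build-TX a f (C j k)    = cong (ctx j) (trans (cong (precede a f) (sym (□-plug₁ k))) (sym (plug₁-precede a f (hole [] []) k)))
  build-TX a f (CT _ _ _) = refl
  build-TX a f (TC _ _ _) = refl
  build-TX a f junk       = refl

  build-CT : ∀ a k i g → build (just a) (normal (attach k i ∷ tree g ∷ [])) ≡ attach (down [] a k g) i
  build-CT a k (tree _)  g = refl
  build-CT a k gap       g = refl
  build-CT a k (ctx _ _) g = refl
  build-CT a k bad       g = refl

  build-TC : ∀ a f k i → build (just a) (normal (tree f ∷ attach k i ∷ [])) ≡ attach (precede a f k) i
  build-TC a f k (tree g)  = cong tree (sym (plug₀-precede a f k g))
  build-TC a f k gap       = refl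
  build-TC a f k (ctx j g) = cong (ctx j) (sym (plug₁-precede a f k g))
  build-TC a f k bad       = refl

  build-lone : ∀ a {i} → Solid i → build (just a) (normal (i ∷ [])) ≡ bad
  build-lone a tree = refl
  build-lone a ctx  = refl
  build-lone a bad  = refl

  guard-breadth : ∀ (s : F) {i} → 1 ≤ breadth (word s) → guard s i ≡ bad
  guard-breadth ∅          ()
  guard-breadth (T _)      _ = refl
  guard-breadth (TT _ _)   _ = refl
  guard-breadth X          ()
  guard-breadth (XT _)     _ = refl
  guard-breadth (TX _)     _ = refl
  guard-breadth (XTT _ _)  _ = refl
  guard-breadth (TXT _ _)  _ = refl
  guard-breadth (TTX _ _)  _ = refl
  guard-breadth (C _ _)    _ = refl
  guard-breadth (CT _ _ _) _ = refl
  guard-breadth (TC _ _ _) _ = refl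
  guard-breadth junk       _ = refl

  build-nothing : ∀ u → 1 ≤ breadth u → build nothing (normal u) ≡ bad
  build-nothing u p with normal-exact u
  ... | inj₁ e             = guard-breadth (normal u) (≤-trans p (≤-reflexive (cong breadth (sym e))))
  ... | inj₂ (e , _)       = cong (λ s → guard s (tree [])) e

  normal-wide-around : ∀ (l v r : W) → 3 ≤ breadth l + breadth r + breadth v → normal (l ++ v ++ r) ≡ junk
  normal-wide-around l v r p = normal-wide {u = l ++ v ++ r} (≤-trans p (breadth-around l v r))

  -- Disposes of the nodes that are `bad` already before filling, since filling can only raise the
  -- breadth. The threshold `n` is 3 in general, and 1 for the label `⊥`, which admits no children.
  build-fill-bad : ∀ {n} a l m r t → (∀ u → n ≤ breadth u → build a (normal u) ≡ bad) →
                   n ≤ breadth l + breadth r + breadth (m ∷ []) →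
                   build a (normal (l ++ fill m t ++ r)) ∷ [] ≡ fill (build a (normal (l ++ m ∷ r))) t
  build-fill-bad a l m r t is-bad p = trans
    (cong (_∷ []) (is-bad (l ++ fill m t ++ r)
      (≤-trans p (≤-trans (+-monoʳ-≤ (breadth l + breadth r) (fill-breadth m t)) (breadth-around l (fill m t) r)))))
    (cong (λ i → fill i t) (sym (is-bad (l ++ m ∷ r) (≤-trans p (breadth-around l (m ∷ []) r)))))

  -- Filling commutes with decoding one node. Iterated along the path to the parameter, this gives
  -- the substitution law for whole contexts.
  build-fill : ∀ a m {l r} t → Sides l r →
               build a (normal (l ++ fill m t ++ r)) ∷ [] ≡ fill (build a (normal (l ++ m ∷ r))) t
  build-fill a m {l} {r} t (wide p) =
    build-fill-bad a l m r t (λ u → build-wide a {u}) (≤-trans p (m≤m+n _ _))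
  build-fill a bad {l} {r} t _ =
    build-fill-bad a l bad r t (λ u → build-wide a {u}) (m≤n+m 3 (breadth l + breadth r))
  build-fill nothing gap t none =
    cong (λ s → build nothing s ∷ []) (trans (cong normal (++-identityʳ (word t))) (normal-word t))
  build-fill nothing gap {l} {r} t right     = build-fill-bad nothing l gap r t build-nothing (s≤s z≤n)
  build-fill nothing gap {l} {r} t left      = build-fill-bad nothing l gap r t build-nothing (s≤s z≤n)
  build-fill nothing gap {l} {r} t two-right = build-fill-bad nothing l gap r t build-nothing (s≤s z≤n)
  build-fill nothing gap {l} {r} t both      = build-fill-bad nothing l gap r t build-nothing (s≤s z≤n)
  build-fill nothing gap {l} {r} t two-left  = build-fill-bad nothing l gap r t build-nothing (s≤s z≤n)
  build-fill nothing m@(tree _)  {l} {r} t _ =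
    build-fill-bad nothing l m r t build-nothing (m≤n+m 1 (breadth l + breadth r))
  build-fill nothing m@(ctx _ _) {l} {r} t _ =
    build-fill-bad nothing l m r t build-nothing (m≤n+m 1 (breadth l + breadth r))
  build-fill (just a) gap t none = cong (_∷ []) (trans
    (cong (build (just a)) (trans (cong normal (++-identityʳ (word t))) (normal-word t))) (sym (build-□ a t)))
  build-fill (just a) gap t (right {g}) = cong (_∷ []) (build-XT a t g)
  build-fill (just a) gap t (left {f})  = cong (_∷ []) (build-TX a f t)
  -- Both children are present: a filler of positive breadth makes both sides `bad`, and the two
  -- others are computed.
  build-fill (just a) gap t (two-right {f} {g}) with vacuous t
  ... | inj₁ refl        = refl
  ... | inj₂ (inj₁ refl) = refl
  ... | inj₂ (inj₂ p) rewrite guard-breadth t {tree (node a f ∷ g)} p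
      | normal-wide-around [] (word t) (tree f ∷ tree g ∷ []) (s≤s (s≤s p)) = refl
  build-fill (just a) gap t (both {f} {g}) with vacuous t
  ... | inj₁ refl        = refl
  ... | inj₂ (inj₁ refl) = refl
  ... | inj₂ (inj₂ p) rewrite guard-breadth t {tree (node a f ∷ g)} p
      | normal-wide-around (tree f ∷ []) (word t) (tree g ∷ []) (s≤s (s≤s p)) = refl
  build-fill (just a) gap t (two-left {f} {g}) with vacuous t
  ... | inj₁ refl        = refl
  ... | inj₂ (inj₁ refl) = refl
  ... | inj₂ (inj₂ p) rewrite guard-breadth t {tree (node a f ∷ g)} p
      | normal-wide-around (tree f ∷ tree g ∷ []) (word t) [] (s≤s (s≤s p)) = refl
  build-fill (just a) (tree f) t none with vacuous t
  ... | inj₁ refl        = refl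
  ... | inj₂ (inj₁ refl) = refl
  ... | inj₂ (inj₂ p) rewrite guard-breadth t {tree f} p = refl
  build-fill (just a) (tree f) t (right {g}) with vacuous t
  ... | inj₁ refl        = refl
  ... | inj₂ (inj₁ refl) = refl
  ... | inj₂ (inj₂ p) rewrite guard-breadth t {tree f} p | guard-breadth t {tree (node a f ∷ g)} p = refl
  build-fill (just a) (tree g) t (left {f}) with vacuous t
  ... | inj₁ refl        = refl
  ... | inj₂ (inj₁ refl) = refl
  ... | inj₂ (inj₂ p) rewrite guard-breadth t {tree g} p | guard-breadth t {tree (node a f ∷ g)} p = refl
  build-fill (just a) (ctx j k) t none =
    cong (_∷ []) (build-lone a (attach-solid k (demand j t)))
  build-fill (just a) (ctx j k) t (right {g}) = cong (_∷ []) (build-CT a k (demand j t) g)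
  build-fill (just a) (ctx j k) t (left {f})  = cong (_∷ []) (build-TC a f k (demand j t))
  build-fill a m@(tree _) {l} {r} t two-right = build-fill-bad a l m r t (λ u → build-wide a {u}) ≤-refl
  build-fill a m@(tree _) {l} {r} t both      = build-fill-bad a l m r t (λ u → build-wide a {u}) ≤-refl
  build-fill a m@(tree _) {l} {r} t two-left  = build-fill-bad a l m r t (λ u → build-wide a {u}) ≤-refl
  build-fill a m@(ctx _ _) {l} {r} t two-right = build-fill-bad a l m r t (λ u → build-wide a {u}) ≤-refl
  build-fill a m@(ctx _ _) {l} {r} t both      = build-fill-bad a l m r t (λ u → build-wide a {u}) ≤-refl
  build-fill a m@(ctx _ _) {l} {r} t two-left  = build-fill-bad a l m r t (λ u → build-wide a {u}) ≤-refl

  -- When the marked item is a tree, its position among the trees is not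
  -- recorded in the form; any choice gives the same result.
  vertical-sides : ∀ m {l r} t → Sides l r → normal (l ++ fill m t ++ r) ≡ vertical (normal (l ++ m ∷ r)) t
  vertical-sides m {l} {r} t (wide p) = trans
    (normal-wide-around l (fill m t) r (≤-trans p (m≤m+n _ _)))
    (cong (λ s → vertical s t) (sym (normal-wide-around l (m ∷ []) r (≤-trans p (m≤m+n _ _)))))
  vertical-sides bad {l} {r} t _ = trans
    (normal-wide-around l (bad ∷ []) r (m≤n+m 3 (breadth l + breadth r)))
    (cong (λ s → vertical s t) (sym (normal-wide-around l (bad ∷ []) r (m≤n+m 3 (breadth l + breadth r)))))
  vertical-sides gap       t none      = refl
  vertical-sides gap       t right     = refl
  vertical-sides gap       t left      = refl
  vertical-sides gap       t two-right = refl
  vertical-sides gap       t both      = refl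
  vertical-sides gap       t two-left  = refl
  vertical-sides (ctx _ _) t none      = refl
  vertical-sides (ctx _ _) t right     = refl
  vertical-sides (ctx _ _) t left      = refl
  vertical-sides (tree _)  t none      = refl
  vertical-sides (tree _)  t right     = refl
  vertical-sides (tree g)  t (left {f}) with vacuous t
  ... | inj₁ refl        = refl
  ... | inj₂ (inj₁ refl) = refl
  ... | inj₂ (inj₂ p) rewrite guard-breadth t {tree f} p | guard-breadth t {tree g} p = refl
  vertical-sides m@(ctx _ _) {l} {r} t two-right = normal-wide-around l (fill m t) r (+-monoʳ-≤ 2 (fill-breadth m t))
  vertical-sides m@(ctx _ _) {l} {r} t both      = normal-wide-around l (fill m t) r (+-monoʳ-≤ 2 (fill-breadth m t))
  vertical-sides m@(ctx _ _) {l} {r} t two-left  = normal-wide-around l (fill m t) r (+-monoʳ-≤ 2 (fill-breadth m t))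
  vertical-sides m@(tree _)  {l} {r} t two-right = normal-wide-around l (fill m t) r (+-monoʳ-≤ 2 (fill-breadth m t))
  vertical-sides m@(tree _)  {l} {r} t both      = normal-wide-around l (fill m t) r (+-monoʳ-≤ 2 (fill-breadth m t))
  vertical-sides m@(tree _)  {l} {r} t two-left  = normal-wide-around l (fill m t) r (+-monoʳ-≤ 2 (fill-breadth m t))

  -- Decoding commutes with the operations of the forest algebra

  decode₀ : 𝓕₀ (L ⊎⊥) → W
  decode₀ []             = []
  decode₀ (node a f ∷ g) = build a (normal (decode₀ f)) ∷ decode₀ g

  marked : 𝓕₁ (L ⊎⊥) → I
  decode₁ : 𝓕₁ (L ⊎⊥) → W
  marked (hole _ _)     = gap
  marked (down _ a c _) = build a (normal (decode₁ c))
  decode₁ c@(hole l r)     = decode₀ l ++ marked c ∷ decode₀ r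
  decode₁ c@(down l _ _ r) = decode₀ l ++ marked c ∷ decode₀ r

  decode : 𝓕 (L ⊎⊥) → W
  decode (inj₁ f) = decode₀ f
  decode (inj₂ c) = decode₁ c

  decode₀-++ : ∀ f g → decode₀ (f ++ g) ≡ decode₀ f ++ decode₀ g
  decode₀-++ []             g = refl
  decode₀-++ (node a f ∷ h) g = cong (_ ∷_) (decode₀-++ h g)

  decode-splice : ∀ l l′ i r′ r → decode₀ (l ++ l′) ++ i ∷ decode₀ (r′ ++ r) ≡
                  decode₀ l ++ (decode₀ l′ ++ i ∷ decode₀ r′) ++ decode₀ r
  decode-splice l l′ i r′ r = begin
    decode₀ (l ++ l′) ++ i ∷ decode₀ (r′ ++ r)
      ≡⟨ cong₂ (λ u v → u ++ i ∷ v) (decode₀-++ l l′) (decode₀-++ r′ r) ⟩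
    (decode₀ l ++ decode₀ l′) ++ i ∷ decode₀ r′ ++ decode₀ r
      ≡⟨ ++-assoc (decode₀ l) (decode₀ l′) _ ⟩
    decode₀ l ++ decode₀ l′ ++ i ∷ decode₀ r′ ++ decode₀ r
      ≡⟨ cong (decode₀ l ++_) (++-assoc (decode₀ l′) (i ∷ decode₀ r′) (decode₀ r)) ⟨
    decode₀ l ++ (decode₀ l′ ++ i ∷ decode₀ r′) ++ decode₀ r ∎
    where open ≡-Reasoning

  decode-flank : ∀ l v r → decode (flank l v r) ≡ decode₀ l ++ decode v ++ decode₀ r
  decode-flank l (inj₁ f) r = trans (decode₀-++ l (f ++ r)) (cong (decode₀ l ++_) (decode₀-++ f r))
  decode-flank l (inj₂ (hole l′ r′)) r       = decode-splice l l′ gap r′ r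
  decode-flank l (inj₂ c@(down l′ _ _ r′)) r = decode-splice l l′ (marked c) r′ r

  decode-root : ∀ a v → decode (root a v) ≡ build a (normal (decode v)) ∷ []
  decode-root a (inj₁ _) = refl
  decode-root a (inj₂ _) = refl

  guard-plain : ∀ (s : F) {i} → Plain i → Plain (guard s i)
  guard-plain s {i} p with vacuous s
  ... | inj₁ refl        = p
  ... | inj₂ (inj₁ refl) = p
  ... | inj₂ (inj₂ q) rewrite guard-breadth s {i} q = bad

  build-plain : ∀ a {u} → Sides u [] → Plain (build a (normal u))
  build-plain nothing  {u} _        = guard-plain (normal u) tree
  build-plain (just _) none         = bad
  build-plain (just _) left         = bad
  build-plain (just _) two-left     = tree
  build-plain (just a) {u} (wide p) rewrite build-wide (just a) {u} (≤-trans p (≤-reflexive (+-identityʳ _))) = bad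

  decode₀-plain : ∀ f → All Plain (decode₀ f)
  decode₀-plain []             = []
  decode₀-plain (node a f ∷ g) = build-plain a (sides (decode₀-plain f) []) ∷ decode₀-plain g

  outerˡ outerʳ : 𝓕₁ (L ⊎⊥) → 𝓕₀ (L ⊎⊥)
  outerˡ (hole l _)     = l
  outerˡ (down l _ _ _) = l
  outerʳ (hole _ r)     = r
  outerʳ (down _ _ _ r) = r

  decode₁-split : ∀ c → decode₁ c ≡ decode₀ (outerˡ c) ++ marked c ∷ decode₀ (outerʳ c)
  decode₁-split (hole _ _)     = refl
  decode₁-split (down _ _ _ _) = refl

  -- Induction on the path to the parameter: at each node `build-fill` exchanges filling and
  -- decoding. The siblings of the top level stay outside `fill`, where `build-fill` for the node
  -- above expects them.
  normal-plug : ∀ c g →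
    normal (decode (plug c g)) ≡ normal (decode₀ (outerˡ c) ++ fill (marked c) (normal (decode g)) ++ decode₀ (outerʳ c))
  normal-plug (hole l r) g = trans (cong normal (decode-flank l g r))
    (normal-mid (decode₀ l) (decode₀ r) (sym (normal-word (normal (decode g)))))
  normal-plug (down l a c r) g = cong normal (begin
    decode (flank l (root a (plug c g)) r)
      ≡⟨ decode-flank l (root a (plug c g)) r ⟩
    decode₀ l ++ decode (root a (plug c g)) ++ decode₀ r
      ≡⟨ cong (λ u → decode₀ l ++ u ++ decode₀ r) (begin
           decode (root a (plug c g))
             ≡⟨ decode-root a (plug c g) ⟩
           build a (normal (decode (plug c g))) ∷ []
             ≡⟨ cong (λ s → build a s ∷ []) (normal-plug c g) ⟩
           build a (normal (decode₀ (outerˡ c) ++ fill (marked c) t ++ decode₀ (outerʳ c))) ∷ []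
             ≡⟨ build-fill a (marked c) t (sides (decode₀-plain (outerˡ c)) (decode₀-plain (outerʳ c))) ⟩
           fill (build a (normal (decode₀ (outerˡ c) ++ marked c ∷ decode₀ (outerʳ c)))) t
             ≡⟨ cong (λ u → fill (build a (normal u)) t) (decode₁-split c) ⟨
           fill (build a (normal (decode₁ c))) t ∎) ⟩
    decode₀ l ++ fill (build a (normal (decode₁ c))) t ++ decode₀ r ∎)
    where
    open ≡-Reasoning
    t = normal (decode g)

  value : 𝓕 (L ⊎⊥) → F
  value v = normal (decode v)

  -- `normal-plug` knows the position of the parameter; `vertical-sides` replaces this knowledge by
  -- what `locate` finds in the form.
  value-plug : ∀ c g → value (plug c g) ≡ vertical (value (inj₂ c)) (value g)
  value-plug c g = trans (normal-plug c g) (trans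
    (vertical-sides (marked c) (value g) (sides (decode₀-plain (outerˡ c)) (decode₀-plain (outerʳ c))))
    (cong (λ u → vertical (normal u) (value g)) (sym (decode₁-split c))))

  value-root : ∀ a v → value (root a v) ≡ normal (build a (value v) ∷ [])
  value-root a v = cong normal (decode-root a v)

  value-vconcat : ∀ v₁ v₂ {v} → vconcat v₁ v₂ ≡ just v → value v ≡ vertical (value v₁) (value v₂)
  value-vconcat (inj₂ c) g refl = value-plug c g

  value-hconcat : ∀ v₁ v₂ {v} → hconcat v₁ v₂ ≡ just v → value v ≡ value v₁ ⊙ value v₂
  value-hconcat (inj₁ f) g refl = trans (cong normal (trans (decode-flank f g [])
    (cong (decode₀ f ++_) (++-identityʳ (decode g))))) (normal-++ (decode₀ f) (decode g))
  value-hconcat (inj₂ c) (inj₁ g) refl =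
    trans (cong normal (decode-flank [] (inj₂ c) g)) (normal-++ (decode₁ c) (decode₀ g))

  decode-fcns : ∀ f → decode₀ (fcns f ∷ []) ≡ tree f ∷ []
  decode-fcns []             = refl
  decode-fcns (node a f ∷ g) = cong (λ u → build (just a) (normal u) ∷ [])
    (trans (decode₀-++ (fcns f ∷ []) (fcns g ∷ [])) (cong₂ _++_ (decode-fcns f) (decode-fcns g)))

  value-fcns : ∀ f → value (inj₁ (fcns f ∷ [])) ≡ T f
  value-fcns f = cong normal (decode-fcns f)

-- Translation of expressions

-- The awaited label is kept apart from the code, so that one program with thirteen-way branches
-- serves every alphabet.
Code : Set
Code = Fin 13

module _ {L A B : Set} where

  code : Form L A B → Code
  code ∅          = # 0
  code (T _)      = # 1
  code (TT _ _)   = # 2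
  code X          = # 3
  code (XT _)     = # 4
  code (TX _)     = # 5
  code (XTT _ _)  = # 6
  code (TXT _ _)  = # 7
  code (TTX _ _)  = # 8
  code (C _ _)    = # 9
  code (CT _ _ _) = # 10
  code (TC _ _ _) = # 11
  code junk       = # 12

  awaited : Form L A B → Maybe L
  awaited (C j _)    = j
  awaited (CT j _ _) = j
  awaited (TC _ j _) = j
  awaited _          = nothing

  contents : Form L A B → List (A ⊎ B)
  contents ∅          = []
  contents (T f)      = inj₁ f ∷ []
  contents (TT f g)   = inj₁ f ∷ inj₁ g ∷ []
  contents X          = []
  contents (XT f)     = inj₁ f ∷ []
  contents (TX f)     = inj₁ f ∷ []
  contents (XTT f g)  = inj₁ f ∷ inj₁ g ∷ []
  contents (TXT f g)  = inj₁ f ∷ inj₁ g ∷ []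
  contents (TTX f g)  = inj₁ f ∷ inj₁ g ∷ []
  contents (C _ k)    = inj₂ k ∷ []
  contents (CT _ k f) = inj₂ k ∷ inj₁ f ∷ []
  contents (TC f _ k) = inj₁ f ∷ inj₂ k ∷ []
  contents junk       = []

-- The entries follow the numbering of `code`, whence `unpack` undoes `pack`. Forests and contexts
-- share the type `E`; the code tells which slot holds which.
forms : {L E : Set} → Maybe L → E → E → Vec (Form L E E) 13
forms j p q = ∅ ∷ T p ∷ TT p q ∷ X ∷ XT p ∷ TX p ∷ XTT p q ∷ TXT p q ∷ TTX p q ∷
              C j p ∷ CT j p q ∷ TC p j q ∷ junk ∷ []

form : {L E : Set} → Code → Maybe L → E → E → Form L E E
form c j p q = Vec.lookup (forms j p q) c

-- Slots without content are padded with ε, except that a variable always has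
-- its two variables as slots: a right-hand side without operations must not
-- acquire any.
record Rep (L V : Set) : Set where
  constructor rep
  field
    code-of    : Code
    awaited-of : Maybe L
    slot₀ slot₁ : Expr L V

open Rep public

-- Forests and contexts are denoted by the same expressions; the two sorts reappear in the relations
-- of `evaluates`.
exprs : (L V : Set) → Alg L
exprs L V = record
  { A    = Expr L V
  ; B    = Expr L V
  ; emp  = ε
  ; tt   = λ a e e′ → op a e ∙ e′
  ; □    = x
  ; ct   = λ a e e′ → op a e ∙ e′
  ; tc   = λ a e e′ → op a e ∙ e′
  ; sub₀ = _⟨_⟩
  ; sub₁ = _⟨_⟩
  }

module _ {L V : Set} where

  nth₀ nth₁ : List (Expr L V ⊎ Expr L V) → Expr L V
  nth₀ []          = ε
  nth₀ (e ∷ _)     = reduce e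
  nth₁ (_ ∷ e ∷ _) = reduce e
  nth₁ _           = ε

  pack : Form L (Expr L V) (Expr L V) → Rep L V
  pack s = rep (code s) (awaited s) (nth₀ (contents s)) (nth₁ (contents s))

  unpack : Rep L V → Form L (Expr L V) (Expr L V)
  unpack (rep c j p q) = form c j p q

  module E = Ops (exprs L V)

  _∙ᴿ_ _⟨_⟩ᴿ : Rep L V → Rep L V → Rep L V
  r ∙ᴿ r′   = pack (unpack r ⊙ unpack r′)
  r ⟨ r′ ⟩ᴿ = pack (E.vertical (unpack r) (unpack r′))

  opᴿ : Maybe L → Rep L V → Rep L V
  opᴿ a r = pack (normal (E.build a (unpack r) ∷ []))

module _ {L V V′ : Set} (atom : V → Rep L V′) where

  translate : Expr (L ⊎⊥) V → Rep L V′
  translate ε           = pack ∅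
  translate x           = pack X
  translate (e₁ ∙ e₂)   = translate e₁ ∙ᴿ translate e₂
  translate (e₁ ⟨ e₂ ⟩) = translate e₁ ⟨ translate e₂ ⟩ᴿ
  translate (op a e)    = opᴿ a (translate e)
  translate (var A)     = atom A

-- Codes, labels and contents of related forms

module _ {L L′ A A′ B B′ : Set} {RL : L → L′ → Set} {RA : A → A′ → Set} {RB : B → B′ → Set} where
  open Relations RL RA RB

  data ContentRel : A ⊎ B → A′ ⊎ B′ → Set where
    inj₁ : ∀ {f f′} → RA f f′ → ContentRel (inj₁ f) (inj₁ f′)
    inj₂ : ∀ {k k′} → RB k k′ → ContentRel (inj₂ k) (inj₂ k′)

  code-rel : ∀ {s s′} → FormRel s s′ → code s ≡ code s′
  code-rel ∅          = refl
  code-rel (T _)      = refl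
  code-rel (TT _ _)   = refl
  code-rel X          = refl
  code-rel (XT _)     = refl
  code-rel (TX _)     = refl
  code-rel (XTT _ _)  = refl
  code-rel (TXT _ _)  = refl
  code-rel (TTX _ _)  = refl
  code-rel (C _ _)    = refl
  code-rel (CT _ _ _) = refl
  code-rel (TC _ _ _) = refl
  code-rel junk       = refl

  awaited-rel : ∀ {s s′} → FormRel s s′ → MP.Pointwise RL (awaited s) (awaited s′)
  awaited-rel ∅          = nothing
  awaited-rel (T _)      = nothing
  awaited-rel (TT _ _)   = nothing
  awaited-rel X          = nothing
  awaited-rel (XT _)     = nothing
  awaited-rel (TX _)     = nothing
  awaited-rel (XTT _ _)  = nothing
  awaited-rel (TXT _ _)  = nothing
  awaited-rel (TTX _ _)  = nothing
  awaited-rel (C j _)    = j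
  awaited-rel (CT j _ _) = j
  awaited-rel (TC _ j _) = j
  awaited-rel junk       = nothing

  contents-rel : ∀ {s s′} → FormRel s s′ → Pointwise ContentRel (contents s) (contents s′)
  contents-rel ∅          = []
  contents-rel (T p)      = inj₁ p ∷ []
  contents-rel (TT p q)   = inj₁ p ∷ inj₁ q ∷ []
  contents-rel X          = []
  contents-rel (XT p)     = inj₁ p ∷ []
  contents-rel (TX p)     = inj₁ p ∷ []
  contents-rel (XTT p q)  = inj₁ p ∷ inj₁ q ∷ []
  contents-rel (TXT p q)  = inj₁ p ∷ inj₁ q ∷ []
  contents-rel (TTX p q)  = inj₁ p ∷ inj₁ q ∷ []
  contents-rel (C _ p)    = inj₂ p ∷ []
  contents-rel (CT _ p q) = inj₂ p ∷ inj₁ q ∷ []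
  contents-rel (TC p _ q) = inj₁ p ∷ inj₂ q ∷ []
  contents-rel junk       = []

pointwise-≡ : {L : Set} {j j′ : Maybe L} → MP.Pointwise _≡_ j j′ → j ≡ j′
pointwise-≡ nothing     = refl
pointwise-≡ (just refl) = refl

module _ {L L′ E E′ : Set} {RL : L → L′ → Set} {R : E → E′ → Set} where
  open Relations RL R R

  form-rel : ∀ {j j′ p p′ q q′} c → MP.Pointwise RL j j′ → R p p′ → R q q′ →
             FormRel (form c j p q) (form c j′ p′ q′)
  form-rel c j p q = VP.lookup {_∼_ = FormRel} (∅ ∷ T p ∷ TT p q ∷ X ∷ XT p ∷ TX p ∷ XTT p q ∷ TXT p q ∷ TTX p q ∷
    C j p ∷ CT j p q ∷ TC p j q ∷ junk ∷ []) c

module _ {L V L′ A B : Set} {RL : L → L′ → Set} {RA : Expr L V → A → Set} {RB : Expr L V → B → Set}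
         (P : Expr L V → Set) (P-ε : P ε)
         (RA⇒P : ∀ {e f} → RA e f → P e) (RB⇒P : ∀ {e k} → RB e k → P e) where
  open Relations RL RA RB

  private
    reduce-P : ∀ {e c} → ContentRel {RL = RL} {RA} {RB} e c → P (reduce e)
    reduce-P (inj₁ p) = RA⇒P p
    reduce-P (inj₂ p) = RB⇒P p

    nth-P : ∀ {cs cs′} → Pointwise (ContentRel {RL = RL} {RA} {RB}) cs cs′ → P (nth₀ cs) × P (nth₁ cs)
    nth-P []           = P-ε , P-ε
    nth-P (q ∷ [])     = reduce-P q , P-ε
    nth-P (q ∷ q′ ∷ _) = reduce-P q , reduce-P q′

  -- `P` will be definedness in one application and a restriction on variables in another; it must
  -- hold for the padding as well.
  pack-slots : ∀ {s s′} → FormRel s s′ → P (slot₀ (pack s)) × P (slot₁ (pack s))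
  pack-slots p = nth-P (contents-rel p)

-- Correctness of the translation of expressions

module _ {L V : Set} where

  deterministic : ∀ {ρ : V → Expr L V} {e v w} → ρ ⊢ e ⇓ v → ρ ⊢ e ⇓ w → v ≡ w
  deterministic ε ε = refl
  deterministic x x = refl
  deterministic ((d₁ ∙ d₂) p) ((d₁′ ∙ d₂′) p′) with deterministic d₁ d₁′ | deterministic d₂ d₂′
  ... | refl | refl with trans (sym p) p′
  ... | refl = refl
  deterministic ((d₁ ⟨ d₂ ⟩) p) ((d₁′ ⟨ d₂′ ⟩) p′) with deterministic d₁ d₁′ | deterministic d₂ d₂′
  ... | refl | refl with trans (sym p) p′
  ... | refl = refl
  deterministic (op d) (op d′) = cong (root _) (deterministic d d′)
  deterministic (var d) (var d′) = deterministic d d′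

  Defined : (V → Expr L V) → Expr L V → Set
  Defined ρ e = ∃[ v ] ρ ⊢ e ⇓ v

  evaluates : (ρ : V → Expr L V) → AlgRel (exprs L V) (forests {L})
  evaluates ρ = record
    { RL   = _≡_
    ; RA   = λ e f → ρ ⊢ e ⇓ inj₁ f
    ; RB   = λ e k → ρ ⊢ e ⇓ inj₂ k
    ; emp  = ε
    ; tt   = λ { {a} {f′ = f} {g′ = g} refl p q → (op p ∙ q) (cong (λ h → just (inj₁ (node a f ∷ h))) (++-identityʳ g)) }
    ; □    = x
    ; ct   = λ { refl p q → (op p ∙ q) refl }
    ; tc   = λ { {k′ = hole l r} refl p q → (op p ∙ q) (cong (λ r → just (inj₂ (hole _ r))) (++-identityʳ r))
               ; {k′ = down l b c r} refl p q → (op p ∙ q) (cong (λ r → just (inj₂ (down _ b c r))) (++-identityʳ r)) }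
    ; sub₀ = λ { {k′ = k} {g′ = g} p q → (p ⟨ q ⟩) (cong just (plug-inj₁ k g)) }
    ; sub₁ = λ { {k′ = k} {g′ = g} p q → (p ⟨ q ⟩) (cong just (plug-inj₂ k g)) }
    }

  module _ (ρ : V → Expr L V) where
    open AlgRel (evaluates ρ)

    -- Relatedness says nothing about slots outside the shape, yet an FSLP demands a value for every
    -- variable; hence the last two fields.
    record Realises (r : Rep L V) (s : F {L}) : Set where
      field
        code≡    : code-of r ≡ code s
        awaited≡ : awaited-of r ≡ awaited s
        related  : FormRel (unpack r) s
        defined₀ : Defined ρ (slot₀ r)
        defined₁ : Defined ρ (slot₁ r)

    open Realises public

    related-slots : ∀ {r s} → Realises r s → FormRel (form (code s) (awaited s) (slot₀ r) (slot₁ r)) s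
    related-slots {r} {s} p = ≡.subst₂ (λ c j → FormRel (form c j (slot₀ r) (slot₁ r)) s) (code≡ p) (awaited≡ p) (related p)

    unpack-pack : ∀ {L V} (s : Form L (Expr L V) (Expr L V)) → unpack (pack s) ≡ s
    unpack-pack ∅          = refl
    unpack-pack (T _)      = refl
    unpack-pack (TT _ _)   = refl
    unpack-pack X          = refl
    unpack-pack (XT _)     = refl
    unpack-pack (TX _)     = refl
    unpack-pack (XTT _ _)  = refl
    unpack-pack (TXT _ _)  = refl
    unpack-pack (TTX _ _)  = refl
    unpack-pack (C _ _)    = refl
    unpack-pack (CT _ _ _) = refl
    unpack-pack (TC _ _ _) = refl
    unpack-pack junk       = refl

    pack-realises : ∀ {s s′} → FormRel s s′ → Realises (pack s) s′
    pack-realises {s} p = record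
      { code≡    = code-rel p
      ; awaited≡ = pointwise-≡ (awaited-rel p)
      ; related  = ≡.subst (λ s → FormRel s _) (sym (unpack-pack s)) p
      ; defined₀ = proj₁ slots
      ; defined₁ = proj₂ slots
      }
      where slots = pack-slots (Defined ρ) (_ , ε) (_ ,_) (_ ,_) p

    -- Serves to replace two right-hand sides by the variables that abbreviate them.
    rename-slots : ∀ s {p p′ q q′} → (∀ {v} → ρ ⊢ p ⇓ v → ρ ⊢ p′ ⇓ v) → (∀ {v} → ρ ⊢ q ⇓ v → ρ ⊢ q′ ⇓ v) →
                   FormRel (form (code s) (awaited s) p q) s → FormRel (form (code s) (awaited s) p′ q′) s
    rename-slots ∅          f g r          = r
    rename-slots (T _)      f g (T p)      = T (f p)
    rename-slots (TT _ _)   f g (TT p q)   = TT (f p) (g q)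
    rename-slots X          f g r          = r
    rename-slots (XT _)     f g (XT p)     = XT (f p)
    rename-slots (TX _)     f g (TX p)     = TX (f p)
    rename-slots (XTT _ _)  f g (XTT p q)  = XTT (f p) (g q)
    rename-slots (TXT _ _)  f g (TXT p q)  = TXT (f p) (g q)
    rename-slots (TTX _ _)  f g (TTX p q)  = TTX (f p) (g q)
    rename-slots (C _ _)    f g (C j p)    = C j (f p)
    rename-slots (CT _ _ _) f g (CT j p q) = CT j (f p) (g q)
    rename-slots (TC _ _ _) f g (TC p j q) = TC (f p) j (g q)
    rename-slots junk       f g r          = r

module _ {L V V′ : Set} {ρ : V → Expr (L ⊎⊥) V} {ρ′ : V′ → Expr L V′} (atom : V → Rep L V′)
         (atom-realises : ∀ {A v} → ρ ⊢ ρ A ⇓ v → Realises ρ′ (translate atom (ρ A)) (value v) →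
                          Realises ρ′ (atom A) (value v)) where
  open AlgRel (evaluates ρ′)

  -- Evaluation derivations continue into right-hand sides, so induction on them needs no order on
  -- the variables. What a variable makes of the result for its right-hand side is left to
  -- `atom-realises`.
  translate-realises : ∀ {e v} → ρ ⊢ e ⇓ v → Realises ρ′ (translate atom e) (value v)
  translate-realises ε = pack-realises ρ′ ∅
  translate-realises x = pack-realises ρ′ X
  translate-realises ((_∙_ {v₁ = v₁} {v₂} d₁ d₂) p) =
    ≡.subst (Realises ρ′ _) (sym (value-hconcat v₁ v₂ p))
      (pack-realises ρ′ (⊙-rel (related (translate-realises d₁)) (related (translate-realises d₂))))
  translate-realises ((_⟨_⟩ {v₁ = v₁} {v₂} d₁ d₂) p) =
    ≡.subst (Realises ρ′ _) (sym (value-vconcat v₁ v₂ p))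
      (pack-realises ρ′ (vertical-rel (related (translate-realises d₁)) (related (translate-realises d₂))))
  translate-realises (op {a} {v = v} d) =
    ≡.subst (Realises ρ′ _) (sym (value-root a v))
      (pack-realises ρ′ (normal-rel (build-rel {a = a} {a} (MP.refl refl) (related (translate-realises d)) ∷ [])))
  translate-realises (var d) = atom-realises d (translate-realises d)

-- The translated FSLP

-- The two variables that replace a variable. With `n * 2` in place of `2 * n`, a successor of `n`
-- unfolds to two successors.
even odd : ∀ {n} → Fin n → Fin (n * 2)
even zero    = zero
even (suc i) = suc (suc (even i))
odd zero    = suc zero
odd (suc i) = suc (suc (odd i))

toℕ-even : ∀ {n} (i : Fin n) → toℕ (even i) ≡ toℕ i * 2
toℕ-even zero    = refl
toℕ-even (suc i) = cong (λ k → suc (suc k)) (toℕ-even i)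

toℕ-odd : ∀ {n} (i : Fin n) → toℕ (odd i) ≡ suc (toℕ i * 2)
toℕ-odd zero    = refl
toℕ-odd (suc i) = cong (λ k → suc (suc k)) (toℕ-odd i)

half : ∀ {n} → Fin (n * 2) → Fin n
half {suc n} zero          = zero
half {suc n} (suc zero)    = zero
half {suc n} (suc (suc i)) = suc (half i)

half-even : ∀ {n} (i : Fin n) → half (even i) ≡ i
half-even zero    = refl
half-even (suc i) = cong suc (half-even i)

half-odd : ∀ {n} (i : Fin n) → half (odd i) ≡ i
half-odd zero    = refl
half-odd (suc i) = cong suc (half-odd i)

interleave : ∀ {n} {A : Set} → (Fin n → A) → (Fin n → A) → Fin (n * 2) → A
interleave {suc n} f g zero          = f zero
interleave {suc n} f g (suc zero)    = g zero
interleave {suc n} f g (suc (suc i)) = interleave (f ∘ suc) (g ∘ suc) i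

interleave-even : ∀ {n} {A : Set} (f g : Fin n → A) i → interleave f g (even i) ≡ f i
interleave-even f g zero    = refl
interleave-even f g (suc i) = interleave-even (f ∘ suc) (g ∘ suc) i

interleave-odd : ∀ {n} {A : Set} (f g : Fin n → A) i → interleave f g (odd i) ≡ g i
interleave-odd f g zero    = refl
interleave-odd f g (suc i) = interleave-odd (f ∘ suc) (g ∘ suc) i

interleave-elim : ∀ {n} {A : Set} (f g : Fin n → A) (P : Fin n → A → Set) →
                  (∀ i → P i (f i)) → (∀ i → P i (g i)) → ∀ i → P (half i) (interleave f g i)
interleave-elim {suc n} f g P pf pg zero          = pf zero
interleave-elim {suc n} f g P pf pg (suc zero)    = pg zero
interleave-elim {suc n} f g P pf pg (suc (suc i)) = interleave-elim (f ∘ suc) (g ∘ suc) (P ∘ suc) (pf ∘ suc) (pg ∘ suc) i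

-- Variables of the translation

module _ {L V : Set} where

  -- A predicate on expressions dressed as a relation, so that the parametricity lemmas apply to it.
  tracks : (P : V → Set) → AlgRel (exprs L V) (exprs L V)
  tracks P = record
    { RL   = λ _ _ → ⊤
    ; RA   = λ e _ → All P (variables e)
    ; RB   = λ e _ → All P (variables e)
    ; emp  = []
    ; tt   = λ _ → All.++⁺
    ; □    = []
    ; ct   = λ _ → All.++⁺
    ; tc   = λ _ → All.++⁺
    ; sub₀ = All.++⁺
    ; sub₁ = All.++⁺
    }

  Tracked : (P : V → Set) → Rep L V → Set
  Tracked P r = All P (variables (slot₀ r)) × All P (variables (slot₁ r))

  module _ (P : V → Set) where
    open AlgRel (tracks P)

    unpack-tracked : ∀ r → Tracked P r → FormRel (unpack r) (unpack r)
    unpack-tracked (rep c j p q) (t , t′) = form-rel {R = λ e _ → All P (variables e)} {q′ = q} c (MP.refl _) t t′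

    pack-tracked : ∀ {s} → FormRel s s → Tracked P (pack s)
    pack-tracked = pack-slots (λ e → All P (variables e)) [] (λ p → p) (λ p → p)

  -- `Q` records which old variable a new one stems from. The rules invent no variables, so
  -- everything in the translation stems from a variable of `e`.
  translate-tracked : ∀ {U} (atom : U → Rep L V) (Q : V → U → Set) → (∀ A → Tracked (λ B → Q B A) (atom A)) →
                      ∀ (P : V → Set) e → (∀ {A B} → A ∈ variables e → Q B A → P B) → Tracked P (translate atom e)
  translate-tracked atom Q t P ε           f = [] , []
  translate-tracked atom Q t P x           f = [] , []
  translate-tracked atom Q t P (e₁ ∙ e₂)   f = pack-tracked P (⊙-rel
    (unpack-tracked P (translate atom e₁) (translate-tracked atom Q t P e₁ (f ∘ ∈-++⁺ˡ)))
    (unpack-tracked P (translate atom e₂) (translate-tracked atom Q t P e₂ (f ∘ ∈-++⁺ʳ (variables e₁)))))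
    where open AlgRel (tracks P)
  translate-tracked atom Q t P (e₁ ⟨ e₂ ⟩) f = pack-tracked P (vertical-rel
    (unpack-tracked P (translate atom e₁) (translate-tracked atom Q t P e₁ (f ∘ ∈-++⁺ˡ)))
    (unpack-tracked P (translate atom e₂) (translate-tracked atom Q t P e₂ (f ∘ ∈-++⁺ʳ (variables e₁)))))
    where open AlgRel (tracks P)
  translate-tracked atom Q t P (op a e)    f = pack-tracked P (normal-rel (build-rel {a = a} {a} (MP.refl _)
    (unpack-tracked P (translate atom e) (translate-tracked atom Q t P e f)) ∷ []))
    where open AlgRel (tracks P)
  translate-tracked atom Q t P (var A)     f = All.map (f (here refl)) (proj₁ (t A)) , All.map (f (here refl)) (proj₂ (t A))

-- Size of the translation

module _ {L V : Set} where

  private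
    I′ = Item L (Expr L V) (Expr L V)
    F′ = Form L (Expr L V) (Expr L V)

  itemSize : I′ → ℕ
  itemSize (tree e)  = operations e
  itemSize gap       = 0
  itemSize (ctx _ e) = operations e
  itemSize bad       = 0

  wordSize : List I′ → ℕ
  wordSize []      = 0
  wordSize (i ∷ u) = itemSize i + wordSize u

  formSize : F′ → ℕ
  formSize s = wordSize (word s)

  repSize : Rep L V → ℕ
  repSize r = operations (slot₀ r) + operations (slot₁ r)

  wordSize-++ : ∀ u v → wordSize (u ++ v) ≡ wordSize u + wordSize v
  wordSize-++ []      v = refl
  wordSize-++ (i ∷ u) v = trans (cong (itemSize i +_) (wordSize-++ u v)) (sym (+-assoc (itemSize i) _ _))

  -- A word is kept or dropped altogether, and `junk` has no contents.
  normal-size : ∀ u → formSize (normal u) ≤ wordSize u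
  normal-size u with normal-exact u
  ... | inj₁ e       = ≤-reflexive (cong wordSize e)
  ... | inj₂ (e , _) = ≤-trans (≤-reflexive (cong formSize e)) z≤n

  ⊙-size : ∀ s t → formSize (s ⊙ t) ≤ formSize s + formSize t
  ⊙-size s t = ≤-trans (normal-size (word s ++ word t)) (≤-reflexive (wordSize-++ (word s) (word t)))

  guard-size : ∀ (s : F′) i → itemSize (guard s i) ≤ itemSize i
  guard-size ∅          i = ≤-refl
  guard-size X          i = ≤-refl
  guard-size (T _)      i = z≤n
  guard-size (TT _ _)   i = z≤n
  guard-size (XT _)     i = z≤n
  guard-size (TX _)     i = z≤n
  guard-size (XTT _ _)  i = z≤n
  guard-size (TXT _ _)  i = z≤n
  guard-size (TTX _ _)  i = z≤n
  guard-size (C _ _)    i = z≤n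
  guard-size (CT _ _ _) i = z≤n
  guard-size (TC _ _ _) i = z≤n
  guard-size junk       i = z≤n

  private
    pair≤ : ∀ m n → suc (suc m + n) ≤ m + (n + 0) + 3
    pair≤ m n = ≤-trans (n≤1+n _) (≤-reflexive (lemma m n))
      where
      lemma : ∀ m n → suc (suc (suc (m + n))) ≡ m + (n + 0) + 3
      lemma = solve-∀

  -- The bound is attained for `XT` and `TX`: `op`, `∙` and a new `x`.
  build-size : ∀ a s → itemSize (E.build a s) ≤ formSize s + 3
  build-size nothing  s          = ≤-trans (guard-size s (tree ε)) (≤-trans (s≤s z≤n) (m≤n+m 3 (formSize s)))
  build-size (just a) ∅          = z≤n
  build-size (just a) (T _)      = z≤n
  build-size (just a) (TT f g)   = pair≤ (operations f) (operations g)
  build-size (just a) X          = s≤s z≤n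
  build-size (just a) (XT f)     = ≤-reflexive (trans (+-comm 3 _) (cong (_+ 3) (sym (+-identityʳ _))))
  build-size (just a) (TX f)     = ≤-reflexive (lemma (operations f))
    where
    lemma : ∀ m → suc (suc m + 1) ≡ m + 0 + 3
    lemma = solve-∀
  build-size (just a) (XTT f g)  = pair≤ (operations f) (operations g)
  build-size (just a) (TXT f g)  = pair≤ (operations f) (operations g)
  build-size (just a) (TTX f g)  = pair≤ (operations f) (operations g)
  build-size (just a) (C _ _)    = z≤n
  build-size (just a) (CT _ k f) = pair≤ (operations k) (operations f)
  build-size (just a) (TC f _ k) = pair≤ (operations f) (operations k)
  build-size (just a) junk       = z≤n

  single-size : ∀ s → itemSize (E.single s) ≤ formSize s + 3
  single-size (T f)      = ≤-trans (m≤m+n _ 0) (m≤m+n _ 3)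
  single-size X          = s≤s z≤n
  single-size (XT f)     = ≤-trans (m≤m+n _ 0) (m≤m+n _ 3)
  single-size (TX f)     = ≤-trans (m≤m+n _ 0) (m≤m+n _ 3)
  single-size (C _ k)    = ≤-trans (m≤m+n _ 0) (m≤m+n _ 3)
  single-size ∅          = z≤n
  single-size (TT _ _)   = z≤n
  single-size (XTT _ _)  = z≤n
  single-size (TXT _ _)  = z≤n
  single-size (TTX _ _)  = z≤n
  single-size (CT _ _ _) = z≤n
  single-size (TC _ _ _) = z≤n
  single-size junk       = z≤n

  demand-size : ∀ j s → itemSize (E.demand j s) ≤ formSize s + 3
  demand-size nothing  s = single-size s
  demand-size (just a) s = build-size (just a) s

  attach-size : ∀ k i → itemSize (E.attach k i) ≤ suc (operations k + itemSize i)
  attach-size k (tree _)  = ≤-refl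
  attach-size k gap       = z≤n
  attach-size k (ctx _ _) = ≤-refl
  attach-size k bad       = z≤n

  -- One operation `⟨_⟩` for attaching, and up to three for the awaited node.
  fill-size : ∀ i s → wordSize (E.fill i s) ≤ itemSize i + (formSize s + 4)
  fill-size gap       s = m≤m+n _ 4
  fill-size (tree f)  s = ≤-trans (≤-reflexive (+-identityʳ _)) (≤-trans (guard-size s (tree f)) (m≤m+n _ _))
  fill-size (ctx j k) s = begin
    itemSize (E.attach k (E.demand j s)) + 0  ≡⟨ +-identityʳ _ ⟩
    itemSize (E.attach k (E.demand j s))      ≤⟨ attach-size k (E.demand j s) ⟩
    suc (operations k + itemSize (E.demand j s)) ≤⟨ s≤s (+-monoʳ-≤ (operations k) (demand-size j s)) ⟩
    suc (operations k + (formSize s + 3))     ≡⟨ lemma (operations k) (formSize s) ⟩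
    operations k + (formSize s + 4)           ∎
    where
    open ≤-Reasoning
    lemma : ∀ m n → suc (m + (n + 3)) ≡ m + (n + 4)
    lemma = solve-∀
  fill-size bad       s = z≤n

  locate-size : ∀ (s : F′) → wordSize (before (locate s)) + itemSize (mark (locate s)) + wordSize (after (locate s)) ≡ formSize s
  locate-size ∅          = refl
  locate-size (T f)      = refl
  locate-size (TT f g)   = refl
  locate-size X          = refl
  locate-size (XT f)     = refl
  locate-size (TX f)     = trans (+-identityʳ _) (+-identityʳ _)
  locate-size (XTT f g)  = refl
  locate-size (TXT f g)  = cong (_+ (operations g + 0)) (trans (+-identityʳ _) (+-identityʳ (operations f)))
  locate-size (TTX f g)  = trans (+-identityʳ _) (+-identityʳ _)
  locate-size (C _ _)    = refl
  locate-size (CT _ k f) = refl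
  locate-size (TC f _ k) = trans (+-assoc (operations f + 0) (operations k) 0) (cong (_+ (operations k + 0)) (+-identityʳ (operations f)))
  locate-size junk       = refl

  vertical-size : ∀ s t → formSize (E.vertical s t) ≤ formSize s + (formSize t + 4)
  vertical-size s t = begin
    formSize (E.vertical s t)
      ≤⟨ normal-size (l ++ E.fill m t ++ r) ⟩
    wordSize (l ++ E.fill m t ++ r)
      ≡⟨ trans (wordSize-++ l _) (cong (wordSize l +_) (wordSize-++ (E.fill m t) r)) ⟩
    wordSize l + (wordSize (E.fill m t) + wordSize r)
      ≤⟨ +-monoʳ-≤ (wordSize l) (+-monoˡ-≤ (wordSize r) (fill-size m t)) ⟩
    wordSize l + (itemSize m + (formSize t + 4) + wordSize r)
      ≡⟨ lemma (wordSize l) (itemSize m) (wordSize r) (formSize t + 4) ⟩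
    wordSize l + itemSize m + wordSize r + (formSize t + 4)
      ≡⟨ cong (_+ (formSize t + 4)) (locate-size s) ⟩
    formSize s + (formSize t + 4) ∎
    where
    open ≤-Reasoning
    l = before (locate s)
    m = mark (locate s)
    r = after (locate s)
    lemma : ∀ a b c d → a + (b + d + c) ≡ a + b + c + d
    lemma = solve-∀

  pack-size : ∀ s → repSize (pack s) ≤ formSize s + 2
  pack-size ∅          = ≤-refl
  pack-size (T f)      = ≤-trans (≤-reflexive (cong (_+ 1) (sym (+-identityʳ _)))) (+-monoʳ-≤ _ (s≤s z≤n))
  pack-size (TT f g)   = ≤-trans (≤-reflexive (cong (operations f +_) (sym (+-identityʳ _)))) (m≤m+n _ 2)
  pack-size X          = ≤-refl
  pack-size (XT f)     = ≤-trans (≤-reflexive (cong (_+ 1) (sym (+-identityʳ _)))) (+-monoʳ-≤ _ (s≤s z≤n))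
  pack-size (TX f)     = ≤-trans (≤-reflexive (cong (_+ 1) (sym (+-identityʳ _)))) (+-monoʳ-≤ _ (s≤s z≤n))
  pack-size (XTT f g)  = ≤-trans (≤-reflexive (cong (operations f +_) (sym (+-identityʳ _)))) (m≤m+n _ 2)
  pack-size (TXT f g)  = ≤-trans (≤-reflexive (cong (operations f +_) (sym (+-identityʳ _)))) (m≤m+n _ 2)
  pack-size (TTX f g)  = ≤-trans (≤-reflexive (cong (operations f +_) (sym (+-identityʳ _)))) (m≤m+n _ 2)
  pack-size (C _ k)    = ≤-trans (≤-reflexive (cong (_+ 1) (sym (+-identityʳ _)))) (+-monoʳ-≤ _ (s≤s z≤n))
  pack-size (CT _ k f) = ≤-trans (≤-reflexive (cong (operations k +_) (sym (+-identityʳ _)))) (m≤m+n _ 2)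
  pack-size (TC f _ k) = ≤-trans (≤-reflexive (cong (operations f +_) (sym (+-identityʳ _)))) (m≤m+n _ 2)
  pack-size junk       = ≤-refl

  unpack-size : ∀ r → formSize (unpack r) ≤ repSize r
  unpack-size (rep c j p q) = VA.lookup⁺ {P = λ s → formSize s ≤ m + n} {xs = forms j p q}
    (z≤n ∷ one ∷ two ∷ z≤n ∷ one ∷ one ∷ two ∷ two ∷ two ∷ one ∷ two ∷ two ∷ z≤n ∷ []) c
    where
    m = operations p
    n = operations q
    one : m + 0 ≤ m + n
    one = +-monoʳ-≤ m z≤n
    two : m + (n + 0) ≤ m + n
    two = ≤-reflexive (cong (m +_) (+-identityʳ n))

  ∙ᴿ-size : ∀ r r′ → repSize (r ∙ᴿ r′) ≤ repSize r + repSize r′ + 6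
  ∙ᴿ-size r r′ = ≤-trans (pack-size (unpack r ⊙ unpack r′)) (+-mono-≤
    (≤-trans (⊙-size (unpack r) (unpack r′)) (+-mono-≤ (unpack-size r) (unpack-size r′))) (s≤s (s≤s z≤n)))

  ⟨⟩ᴿ-size : ∀ r r′ → repSize (r ⟨ r′ ⟩ᴿ) ≤ repSize r + repSize r′ + 6
  ⟨⟩ᴿ-size r r′ = begin
    repSize (r ⟨ r′ ⟩ᴿ)                              ≤⟨ pack-size (E.vertical (unpack r) (unpack r′)) ⟩
    formSize (E.vertical (unpack r) (unpack r′)) + 2 ≤⟨ +-monoˡ-≤ 2 (vertical-size (unpack r) (unpack r′)) ⟩
    formSize (unpack r) + (formSize (unpack r′) + 4) + 2
      ≤⟨ +-monoˡ-≤ 2 (+-mono-≤ (unpack-size r) (+-monoˡ-≤ 4 (unpack-size r′))) ⟩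
    repSize r + (repSize r′ + 4) + 2                 ≡⟨ lemma (repSize r) (repSize r′) ⟩
    repSize r + repSize r′ + 6                       ∎
    where
    open ≤-Reasoning
    lemma : ∀ m n → m + (n + 4) + 2 ≡ m + n + 6
    lemma = solve-∀

  opᴿ-size : ∀ a r → repSize (opᴿ a r) ≤ repSize r + 6
  opᴿ-size a r = begin
    repSize (opᴿ a r)                          ≤⟨ pack-size (normal (E.build a (unpack r) ∷ [])) ⟩
    formSize (normal (E.build a (unpack r) ∷ [])) + 2
      ≤⟨ +-monoˡ-≤ 2 (normal-size (E.build a (unpack r) ∷ [])) ⟩
    itemSize (E.build a (unpack r)) + 0 + 2     ≤⟨ +-monoˡ-≤ 2 (+-monoˡ-≤ 0 (build-size a (unpack r))) ⟩
    formSize (unpack r) + 3 + 0 + 2             ≤⟨ +-monoˡ-≤ 2 (+-monoˡ-≤ 0 (+-monoˡ-≤ 3 (unpack-size r))) ⟩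
    repSize r + 3 + 0 + 2                       ≤⟨ ≤-reflexive (lemma (repSize r)) ⟩
    repSize r + 5                               ≤⟨ +-monoʳ-≤ (repSize r) (n≤1+n 5) ⟩
    repSize r + 6                               ∎
    where
    open ≤-Reasoning
    lemma : ∀ m → m + 3 + 0 + 2 ≡ m + 5
    lemma = solve-∀

  -- The factor comes from vertical concatenation: 4 operations for filling and 2 for padding the
  -- slots with `ε`.
  translate-size : ∀ {U} (atom : U → Rep L V) → (∀ A → repSize (atom A) ≡ 0) → ∀ e →
                   repSize (translate atom e) ≤ 6 * operations e
  translate-size atom z ε = s≤s (s≤s z≤n)
  translate-size atom z x = s≤s (s≤s z≤n)
  translate-size atom z (e₁ ∙ e₂) = ≤-trans (∙ᴿ-size (translate atom e₁) (translate atom e₂))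
    (≤-trans (+-monoˡ-≤ 6 (+-mono-≤ (translate-size atom z e₁) (translate-size atom z e₂)))
             (≤-reflexive (distribute (operations e₁) (operations e₂))))
    where
    distribute : ∀ m n → 6 * m + 6 * n + 6 ≡ 6 * suc (m + n)
    distribute = solve-∀
  translate-size atom z (e₁ ⟨ e₂ ⟩) = ≤-trans (⟨⟩ᴿ-size (translate atom e₁) (translate atom e₂))
    (≤-trans (+-monoˡ-≤ 6 (+-mono-≤ (translate-size atom z e₁) (translate-size atom z e₂)))
             (≤-reflexive (distribute (operations e₁) (operations e₂))))
    where
    distribute : ∀ m n → 6 * m + 6 * n + 6 ≡ 6 * suc (m + n)
    distribute = solve-∀
  translate-size atom z (op a e) = ≤-trans (opᴿ-size a (translate atom e))
    (≤-trans (+-monoˡ-≤ 6 (translate-size atom z e)) (≤-reflexive (trans (+-comm _ 6) (sym (*-suc 6 (operations e))))))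
  translate-size atom z (var A) = ≤-reflexive (z A)

sum-interleave : ∀ {n} {A : Set} (w : A → ℕ) (f g : Fin n → A) →
                 sum (tabulate (w ∘ interleave f g)) ≡ sum (tabulate λ i → w (f i) + w (g i))
sum-interleave {zero}  w f g = refl
sum-interleave {suc n} w f g = trans (cong (λ k → w (f zero) + (w (g zero) + k)) (sum-interleave w (f ∘ suc) (g ∘ suc)))
                                     (sym (+-assoc (w (f zero)) (w (g zero)) _))

sum-bound : ∀ {n} c (f g : Fin n → ℕ) → (∀ i → f i ≤ c * g i) → sum (tabulate f) ≤ c * sum (tabulate g)
sum-bound {zero}  c f g p = z≤n
sum-bound {suc n} c f g p = ≤-trans (+-mono-≤ (p zero) (sum-bound c (f ∘ suc) (g ∘ suc) (p ∘ suc)))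
                                    (≤-reflexive (sym (*-distribˡ-+ c (g zero) _)))

-- Construction of the new grammar

module Translation {L : Set} (F : FSLP (L ⊎⊥)) where
  open FSLP F using (start; ρ; acyclic; defined; _occursIn_) public

  n : ℕ
  n = ∣V∣ F

  valueOf : Fin n → Form L (𝓕₀ L) (𝓕₁ L)
  valueOf A = value (proj₁ (defined A))

  atom : Fin n → Rep L (Fin (n * 2))
  atom A = rep (code (valueOf A)) (awaited (valueOf A)) (var (even A)) (var (odd A))

  image : Fin n → Rep L (Fin (n * 2))
  image A = translate atom (ρ A)

  ρ′ : Fin (n * 2) → Expr L (Fin (n * 2))
  ρ′ = interleave (slot₀ ∘ image) (slot₁ ∘ image)

  var-even : ∀ {A v} → ρ′ ⊢ slot₀ (image A) ⇓ v → ρ′ ⊢ var (even A) ⇓ v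
  var-even {A} d = var (≡.subst (λ e → ρ′ ⊢ e ⇓ _) (sym (interleave-even (slot₀ ∘ image) (slot₁ ∘ image) A)) d)

  var-odd : ∀ {A v} → ρ′ ⊢ slot₁ (image A) ⇓ v → ρ′ ⊢ var (odd A) ⇓ v
  var-odd {A} d = var (≡.subst (λ e → ρ′ ⊢ e ⇓ _) (sym (interleave-odd (slot₀ ∘ image) (slot₁ ∘ image) A)) d)

  atom-realises : ∀ {A v} → ρ ⊢ ρ A ⇓ v → Realises ρ′ (image A) (value v) → Realises ρ′ (atom A) (value v)
  atom-realises {A} {v} d r = record
    { code≡    = cong code same
    ; awaited≡ = cong awaited same
    ; related  = ≡.subst (λ s → FormRel (form (code s) (awaited s) (var (even A)) (var (odd A))) (value v)) (sym same)
                   (rename-slots ρ′ (value v) var-even var-odd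
                     (related-slots ρ′ r))
    ; defined₀ = _ , var-even (proj₂ (defined₀ r))
    ; defined₁ = _ , var-odd (proj₂ (defined₁ r))
    }
    where
    open AlgRel (evaluates ρ′) using (FormRel)
    -- The shape of `atom` comes from the derivation chosen in `defined`; the derivation at hand may
    -- be another one, with the same value.
    same : valueOf A ≡ value v
    same = cong value (deterministic (proj₂ (defined A)) (var d))

  realises : ∀ {e v} → ρ ⊢ e ⇓ v → Realises ρ′ (translate atom e) (value v)
  realises = translate-realises atom atom-realises

  image-realises : ∀ A → Realises ρ′ (image A) (valueOf A)
  image-realises A with defined A
  ... | _ , var d = realises d

  defined′ : ∀ i → Defined ρ′ (var i)
  defined′ i = _ , var (proj₂ (interleave-elim _ _ (λ _ → Defined ρ′)
    (λ A → defined₀ (image-realises A)) (λ A → defined₁ (image-realises A)) i))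

  -- `half` maps dependencies to dependencies, hence a cycle of the new grammar to a cycle of the
  -- old one.
  occurs : ∀ {i j} → j ∈ variables (ρ′ i) → half j occursIn half i
  occurs {i} m = All.lookup (interleave-elim _ _ (λ A e → All (λ j → half j occursIn A) (variables e))
                              (proj₁ ∘ tracked) (proj₂ ∘ tracked) i) m
    where
    tracked : ∀ A → Tracked (λ j → half j occursIn A) (image A)
    tracked A = translate-tracked atom (λ j B → half j ≡ B) (λ B → half-even B ∷ [] , half-odd B ∷ [])
                  (λ j → half j occursIn A) (ρ A) λ { m refl → m }

  occurs⁺ : ∀ {i j} → TransClosure (λ j i → j ∈ variables (ρ′ i)) i j → TransClosure _occursIn_ (half i) (half j)
  occurs⁺ [ p ]    = [ occurs p ]
  occurs⁺ (p ∷ ps) = occurs p ∷ occurs⁺ ps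

  -- The value of the old start variable has shape `T`, whose only content sits in the even slot.
  start-ground : ∀ {f} → ⟦ F ⟧ ≡ fcns f ∷ [] → ρ′ ⊢ var (even start) ⇓ inj₁ f
  start-ground {f} p with related-slots ρ′ (≡.subst (Realises ρ′ (image start)) start-value (image-realises start))
    where
    start-value : valueOf start ≡ T f
    start-value = trans (cong value (deterministic (proj₂ (defined start)) (proj₂ (FSLP.ground F))))
                        (trans (cong (value ∘ inj₁) p) (value-fcns f))
  ... | AlgRel.T d = var-even d

  result : ∀ {f} → ⟦ F ⟧ ≡ fcns f ∷ [] → FSLP L
  result p = record
    { ∣V∣     = n * 2
    ; start   = even start
    ; ρ       = ρ′
    ; acyclic = λ i c → acyclic (half i) (occurs⁺ c)
    ; defined = defined′
    ; ground  = _ , start-ground p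
    }

  size-result : ∀ {f} (p : ⟦ F ⟧ ≡ fcns f ∷ []) → size (result p) ≤ 6 * size F
  size-result p = ≤-trans (≤-reflexive (sum-interleave operations (slot₀ ∘ image) (slot₁ ∘ image)))
    (sum-bound 6 (repSize ∘ image) (operations ∘ ρ) (λ A → translate-size atom (λ _ → refl) (ρ A)))

-- The machine program

Tm : ℕ → Set
Tm = Term 4 4

pattern load      = 0F
pattern transform = 1F
pattern visit     = 2F
pattern emit      = 3F

-- There is no multiplication: doubled holds 2 i at i.
pattern rhs     = 0F
pattern doubled = 1F
pattern done    = 2F
pattern memo    = 3F

-- A branch is entered with further local variables, so it is given as a
-- function of the renaming of the old ones.
opaque
  switch : ∀ k {n} → Fin n → (∀ {m} → (Fin n → Fin m) → Fin (suc k) → Tm m) → Tm n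
  switch zero    i b = b id zero
  switch (suc k) i b = ifzero (var i) (b id zero) (switch k zero λ r j → b (r ∘ suc) (suc j))

  optional : ∀ {n} → Fin n → (∀ {m} → (Fin n → Fin m) → Maybe (Fin m) → Tm m) → Tm n
  optional i b = ifzero (var i) (b id nothing) (b suc (just zero))

-- What is known while the program is written down: after the branching, the code and whether a
-- label is awaited; label and slots are only local variables.
record Handle (n : ℕ) : Set where
  constructor handle
  field
    hcode        : Code
    hawaited     : Maybe (Fin n)
    hslot₀ hslot₁ : Fin n

open Handle public

renameᴴ : ∀ {m n} → (Fin m → Fin n) → Handle m → Handle n
renameᴴ r (handle c j p q) = handle c (Maybe.map r j) (r p) (r q)

template : ∀ {n} → Handle n → Rep (Fin n) (Fin n)
template (handle c j p q) = rep c j (var p) (var q)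

past : ∀ {n m l} → (Fin (6 + n) → Fin m) → (Fin m → Fin l) → Fin n → Fin l
past f f′ k = f′ (f (suc (suc (suc (suc (suc (suc k)))))))

components : ∀ {n m l} → (Fin (6 + n) → Fin m) → Maybe (Fin m) → (Fin m → Fin l) → Code → Handle l
components f j f′ c = handle c (Maybe.map f′ j) (f′ (f 0F)) (f′ (f 1F))

opaque
  examine : ∀ {n} → Fin n → (∀ {m} → (Fin n → Fin m) → Handle m → Tm m) → Tm n
  examine i b =
    split (var i) (split (var 1F) (split (var 1F)
      (optional 2F λ f j → switch 12 (f 4F) λ f′ c → b (past f f′) (components f j f′ c))))

-- Labels and variables are both local variables of the program. A variable holds an encoded
-- expression, which is shared and not copied, so only new operations take time.
quoteᴱ : ∀ {n} → Expr (Fin n) (Fin n) → Tm n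
quoteᴱ ε           = cons (lit 0) (lit 0)
quoteᴱ x           = cons (lit 1) (lit 0)
quoteᴱ (e₁ ∙ e₂)   = cons (lit 2) (cons (quoteᴱ e₁) (quoteᴱ e₂))
quoteᴱ (e₁ ⟨ e₂ ⟩) = cons (lit 3) (cons (quoteᴱ e₁) (quoteᴱ e₂))
quoteᴱ (op i e)    = cons (lit 4) (cons (var i) (quoteᴱ e))
quoteᴱ (var i)     = var i

quoteᴬ : ∀ {n} → Maybe (Fin n) → Tm n
quoteᴬ nothing  = lit 0
quoteᴬ (just i) = succ (var i)

quoteᴿ : ∀ {n} → Rep (Fin n) (Fin n) → Tm n
quoteᴿ (rep c j p q) = cons (lit (toℕ c)) (cons (quoteᴬ j) (cons (quoteᴱ p) (quoteᴱ q)))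

opaque
  -- The rule is applied to templates while the program is written down; by
  -- parametricity the generated term builds what the rule gives on expressions.
  binary : (∀ {L V} (s t : Form L (Expr L V) (Expr L V)) → Form L (Expr L V) (Expr L V)) →
           ∀ {n} → Fin n → Fin n → Tm n
  binary _⊗_ i j = examine i λ f h → examine (f j) λ f′ h′ →
    quoteᴿ (pack (unpack (template (renameᴴ f′ h)) ⊗ unpack (template h′)))

  -- In the input, `⊥` has number 0 and any other label the successor of its number in the output,
  -- so `optional` tests for `⊥` and renumbers at once.
  rooted : ∀ {n} → Fin n → Fin n → Tm n
  rooted i j = optional i λ f a → examine (f j) λ f′ h → quoteᴿ (opᴿ (Maybe.map f′ a) (template h))

branch : ∀ {m} → (Fin 3 → Fin m) → Fin 6 → Tm m
branch r 0F = quoteᴿ (pack ∅)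
branch r 1F = quoteᴿ (pack X)
branch r 2F = split (var (r 1F)) (bind (call transform (var 0F)) (bind (call transform (var 2F)) (binary _⊙_ 1F 0F)))
branch r 3F = split (var (r 1F)) (bind (call transform (var 0F)) (bind (call transform (var 2F)) (binary E.vertical 1F 0F)))
branch r 4F = split (var (r 1F)) (bind (call transform (var 1F)) (rooted 1F 0F))
branch r 5F = call visit (var (r 1F))

loadBody transformBody visitBody emitBody main : Tm 1

-- The double of the index that is reached at the end becomes the number of variables of the result.
loadBody =
  split (var 0F)
    (ifzero (var 0F)
      (split (var 1F) (split (var 1F) (var 0F)))
      (split (var 2F) (split (var 1F) (split (var 1F)
        (bind (set rhs (var 4F) (var 0F))
        (bind (set doubled (var 5F) (var 3F))
        (call load (cons (var 8F) (cons (succ (var 6F)) (cons (succ (succ (var 4F))) (var 3F)))))))))))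

transformBody = split (var 0F) (switch 5 0F branch)

visitBody =
  bind
    (ifzero (get done (var 0F))
      (bind (call transform (get rhs (var 0F)))
      (bind (set memo (var 1F) (var 0F))
      (set done (var 2F) (lit 1))))
      (lit 0))
    (split (get memo (var 1F)) (split (var 1F)
      (bind (get doubled (var 5F))
      -- 5 is the tag of variables in `encodeExpr`; the names are the doubled index and its
      -- successor.
      (cons (var 3F) (cons (var 1F) (cons (cons (lit 5) (var 0F)) (cons (lit 5) (succ (var 0F)))))))))

-- Variables that the start variable does not reach are visited as well, since their right-hand
-- sides belong to the output.
emitBody =
  split (var 0F)
    (ifzero (var 0F)
      (lit 0)
      (bind (call visit (var 2F))
      (split (get memo (var 3F)) (split (var 1F) (split (var 1F)
        (bind (call emit (cons (var 7F) (succ (var 9F))))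
        (cons (var 1F) (cons (var 2F) (var 0F)))))))))

main =
  split (var 0F) (split (var 1F)
    (bind (call load (cons (var 2F) (cons (lit 0) (cons (lit 0) (var 1F)))))
    (bind (call emit (cons (var 3F) (lit 0)))
    (cons (var 1F) (cons (get doubled (var 2F)) (var 0F))))))

program : Program
program = record
  { procs  = 4
  ; arrays = 4
  ; body   = lookup (loadBody ∷ transformBody ∷ visitBody ∷ emitBody ∷ [])
  ; main   = main
  }

open Semantics program

-- Evaluation of the generated terms

record Reduces {m n} (γ : Vec Val m) (s : Tm m) (c : ℕ) (γ′ : Vec Val n) (s′ : Tm n) : Set where
  constructor reducing
  field
    back : ∀ {μ v μ′ t} → Eval γ′ s′ μ v μ′ t → ∃[ t′ ] Eval γ s μ v μ′ t′ × t′ ≤ c + t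

open Reduces

record Along {m n} (r : Fin m → Fin n) (γ : Vec Val m) (γ′ : Vec Val n) : Set where
  constructor along
  field
    at : ∀ i → lookup γ′ (r i) ≡ lookup γ i

open Along

var-eval : ∀ {n} {γ : Vec Val n} {i v μ} → lookup γ i ≡ v → Eval γ (var i) μ v μ 1
var-eval refl = var

infixr 1 _then_

_then_ : ∀ {k m n} {γ : Vec Val k} {γ′ : Vec Val m} {γ″ : Vec Val n} {s s′ s″ c c′} →
         Reduces γ s c γ′ s′ → Reduces γ′ s′ c′ γ″ s″ → Reduces γ s (c + c′) γ″ s″
_then_ {c = c} {c′} p q = reducing λ {_} {_} {_} {t} e →
  let t′ , e′ , r′ = back q e
      t″ , e″ , r″ = back p e′
  in t″ , e″ , ≤-trans r″ (≤-trans (+-monoʳ-≤ c r′) (≤-reflexive (sym (+-assoc c c′ t))))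

split-reduces : ∀ {n} {γ : Vec Val n} {i u w s} → lookup γ i ≡ pair u w → Reduces γ (split (var i) s) 2 (u ∷ w ∷ γ) s
split-reduces p = reducing λ e → _ , split (var-eval p) e , ≤-refl

record Switched {n} (γ : Vec Val n) (s : Tm n) (k : ℕ) (b : ∀ {m} → (Fin n → Fin m) → Tm m) : Set where
  constructor switched
  field
    {width}  : ℕ
    {env}    : Vec Val width
    {ren}    : Fin n → Fin width
    extends  : Along ren γ env
    reduces  : Reduces γ s (k * 2) env (b ren)

opaque
  unfolding switch

  -- Each of the at most `k` tests takes two steps, one for the branch and one for the variable.
  switch-reduces : ∀ k {n} {γ : Vec Val n} i (b : ∀ {m} → (Fin n → Fin m) → Fin (suc k) → Tm m) j →
                   lookup γ i ≡ num (toℕ j) → Switched γ (switch k i b) k (λ r → b r j)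
  switch-reduces zero    i b zero    p = switched (along λ _ → refl) (reducing λ e → _ , e , ≤-refl)
  switch-reduces (suc k) i b zero    p =
    switched (along λ _ → refl) (reducing λ e → _ , zeroᵇ (var-eval p) e , s≤s (s≤s (m≤n+m _ _)))
  switch-reduces (suc k) i b (suc j) p with switch-reduces k zero (λ r j → b (r ∘ suc) (suc j)) j refl
  ... | switched (along a) (reducing f) = switched (along λ k → a (suc k))
    (reducing λ e → let _ , e′ , q = f e in _ , sucᵇ (var-eval p) e′ , s≤s (s≤s q))

module _ {σ N : ℕ} where

  encodeRep : Rep (Fin σ) (Fin N) → Val
  encodeRep (rep c j p q) =
    pair (num (toℕ c)) (pair (num (label⊥ j)) (pair (encodeExpr label p) (encodeExpr label q)))

  record Quoted {m} (γ : Vec Val m) (q : Expr (Fin m) (Fin m)) (e : Expr (Fin σ) (Fin N)) : Set where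
    constructor quoting
    field
      run : ∀ {μ} → ∃[ t ] Eval γ (quoteᴱ q) μ (encodeExpr label e) μ t × t ≤ 5 * operations q + 1

  open Quoted

  Holds : ∀ {m} → Vec Val m → Fin m → Fin σ → Set
  Holds γ i a = lookup γ i ≡ num (label a)

  module _ {m} {γ : Vec Val m} where

    pair-quoted : ∀ {q q′ e e′} → Quoted γ q e → Quoted γ q′ e′ → ∀ {μ} →
      ∃[ t ] Eval γ (cons (quoteᴱ q) (quoteᴱ q′)) μ (pair (encodeExpr label e) (encodeExpr label e′)) μ t ×
             t ≤ 5 * (operations q + operations q′) + 3
    pair-quoted {q} {q′} h h′ with run h | run h′
    ... | t , e , p | t′ , e′ , p′ = _ , cons e e′ ,
      ≤-trans (s≤s (+-mono-≤ p p′)) (≤-reflexive (lemma (operations q) (operations q′)))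
      where
      lemma : ∀ m n → suc (5 * m + 1 + (5 * n + 1)) ≡ 5 * (m + n) + 3
      lemma = solve-∀

    tagged-quoted : ∀ {q q′ e e′} k → Quoted γ q e → Quoted γ q′ e′ → ∀ {μ} →
      ∃[ t ] Eval γ (cons (lit k) (cons (quoteᴱ q) (quoteᴱ q′))) μ
                    (pair (num k) (pair (encodeExpr label e) (encodeExpr label e′))) μ t ×
             t ≤ 5 * suc (operations q + operations q′) + 1
    tagged-quoted {q} {q′} k h h′ with pair-quoted h h′
    ... | t , e , p = _ , cons lit e ,
      ≤-trans (s≤s (s≤s p)) (≤-trans (n≤1+n _) (≤-reflexive (lemma (operations q + operations q′))))
      where
      lemma : ∀ m → suc (suc (suc (5 * m + 3))) ≡ 5 * suc m + 1
      lemma = solve-∀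

    labelled-quoted : ∀ {q e i a} → Holds γ i a → Quoted γ q e → Quoted γ (op i q) (op a e)
    labelled-quoted {q} l (quoting f) = quoting λ {μ} →
      let t , e , p = f {μ} in
      _ , cons lit (cons (var-eval l) e) ,
      ≤-trans (s≤s (s≤s (s≤s (s≤s p)))) (≤-trans (n≤1+n _) (≤-reflexive (lemma (operations q))))
      where
      lemma : ∀ m → 5 + (5 * m + 1) ≡ 5 * suc m + 1
      lemma = solve-∀

    -- Relates a template to the expression whose encoding the generated term builds. Parametricity
    -- then turns the rules on forms into correct code.
    quoted : AlgRel (exprs (Fin m) (Fin m)) (exprs (Fin σ) (Fin N))
    quoted = record
      { RL   = Holds γ
      ; RA   = Quoted γ
      ; RB   = Quoted γ
      ; emp  = quoting (_ , cons lit lit , s≤s (s≤s (s≤s z≤n)))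
      ; tt   = λ l p q → quoting (tagged-quoted 2 (labelled-quoted l p) q)
      ; □    = quoting (_ , cons lit lit , s≤s (s≤s (s≤s z≤n)))
      ; ct   = λ l p q → quoting (tagged-quoted 2 (labelled-quoted l p) q)
      ; tc   = λ l p q → quoting (tagged-quoted 2 (labelled-quoted l p) q)
      ; sub₀ = λ p q → quoting (tagged-quoted 3 p q)
      ; sub₁ = λ p q → quoting (tagged-quoted 3 p q)
      }

    open AlgRel quoted using (FormRel)

    awaited-eval : ∀ {j a μ} → MP.Pointwise (Holds γ) j a →
                   ∃[ t ] Eval γ (quoteᴬ j) μ (num (label⊥ a)) μ t × t ≤ 2
    awaited-eval nothing  = _ , lit , s≤s z≤n
    awaited-eval (just p) = _ , succ (var-eval p) , ≤-refl

    nth-quoted : ∀ {c c′} → Pointwise (ContentRel {RL = Holds γ} {Quoted γ} {Quoted γ}) c c′ →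
                 Quoted γ (nth₀ c) (nth₀ c′) × Quoted γ (nth₁ c) (nth₁ c′)
    nth-quoted = λ where
        []           → AlgRel.emp quoted , AlgRel.emp quoted
        (p ∷ [])     → reduced p , AlgRel.emp quoted
        (p ∷ p′ ∷ _) → reduced p , reduced p′
      where
      reduced : ∀ {c c′} → ContentRel {RL = Holds γ} {Quoted γ} {Quoted γ} c c′ → Quoted γ (reduce c) (reduce c′)
      reduced (inj₁ p) = p
      reduced (inj₂ p) = p

    rep-eval : ∀ {c c′ j a p p′ q q′ μ} → c ≡ c′ → MP.Pointwise (Holds γ) j a → Quoted γ p p′ → Quoted γ q q′ →
      ∃[ t ] Eval γ (quoteᴿ (rep c j p q)) μ (encodeRep (rep c′ a p′ q′)) μ t × t ≤ 5 * (operations p + operations q) + 8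
    rep-eval {p = p} {q = q} refl l g₀ g₁ with awaited-eval l | pair-quoted g₀ g₁
    ... | t , e , r | t′ , e′ , r′ = _ , cons lit (cons e e′) ,
      ≤-trans (s≤s (s≤s (s≤s (+-mono-≤ r r′)))) (≤-reflexive (lemma (5 * (operations p + operations q))))
      where
      lemma : ∀ m → 5 + (m + 3) ≡ m + 8
      lemma = solve-∀

    pack-eval : ∀ {s s′ b μ} → FormRel s s′ → repSize (pack s) ≤ b →
                ∃[ t ] Eval γ (quoteᴿ (pack s)) μ (encodeRep (pack s′)) μ t × t ≤ 5 * b + 8
    pack-eval p q with rep-eval (code-rel p) (awaited-rel p) (proj₁ (nth-quoted (contents-rel p))) (proj₂ (nth-quoted (contents-rel p)))
    ... | t , e , r = t , e , ≤-trans r (+-monoˡ-≤ 8 (*-monoʳ-≤ 5 q))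

  record Handles {m} (γ : Vec Val m) (h : Handle m) (r : Rep (Fin σ) (Fin N)) : Set where
    field
      code-held    : hcode h ≡ code-of r
      awaited-held : MP.Pointwise (Holds γ) (hawaited h) (awaited-of r)
      slot₀-held   : lookup γ (hslot₀ h) ≡ encodeExpr label (slot₀ r)
      slot₁-held   : lookup γ (hslot₁ h) ≡ encodeExpr label (slot₁ r)

  open Handles

  rename-holds : ∀ {m n} {γ : Vec Val m} {γ′ : Vec Val n} {r j a} → Along r γ γ′ →
                 MP.Pointwise (Holds γ) j a → MP.Pointwise (Holds γ′) (Maybe.map r j) a
  rename-holds al nothing          = nothing
  rename-holds al (just {i} {a} p) = just (trans (at al i) p)

  rename-handles : ∀ {m n} {γ : Vec Val m} {γ′ : Vec Val n} {r h p} → Along r γ γ′ →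
                   Handles γ h p → Handles γ′ (renameᴴ r h) p
  rename-handles {h = h} al p = record
    { code-held    = code-held p
    ; awaited-held = rename-holds al (awaited-held p)
    ; slot₀-held   = trans (at al (hslot₀ h)) (slot₀-held p)
    ; slot₁-held   = trans (at al (hslot₁ h)) (slot₁-held p)
    }

  var-quoted : ∀ {m} {γ : Vec Val m} {i e} → lookup γ i ≡ encodeExpr label e → Quoted γ (var i) e
  var-quoted p = quoting (_ , var-eval p , ≤-refl)

  template-rel : ∀ {m} {γ : Vec Val m} {h r} → Handles γ h r → AlgRel.FormRel (quoted {γ = γ}) (unpack (template h)) (unpack r)
  template-rel {γ = γ} {h} {r} p = ≡.subst (λ c → AlgRel.FormRel (quoted {γ = γ}) (unpack (template h)) (form c _ _ _)) (code-held p)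
    (form-rel (hcode h) (awaited-held p) (var-quoted (slot₀-held p)) (var-quoted (slot₁-held p)))

  record Optional {n} (γ : Vec Val n) (s : Tm n) (a : Maybe (Fin σ))
                  (b : ∀ {m} → (Fin n → Fin m) → Maybe (Fin m) → Tm m) : Set where
    constructor optionally
    field
      {width}  : ℕ
      {env}    : Vec Val width
      {ren}    : Fin n → Fin width
      {awaits} : Maybe (Fin width)
      extends  : Along ren γ env
      holds    : MP.Pointwise (Holds env) awaits a
      reduces  : Reduces γ s 2 env (b ren awaits)

  opaque
    unfolding switch

    optional-reduces : ∀ {n} {γ : Vec Val n} i (b : ∀ {m} → (Fin n → Fin m) → Maybe (Fin m) → Tm m) a →
                       lookup γ i ≡ num (label⊥ a) → Optional γ (optional i b) a b
    optional-reduces i b nothing  p =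
      optionally (along λ _ → refl) nothing (reducing λ e → _ , zeroᵇ (var-eval p) e , ≤-refl)
    optional-reduces i b (just a) p =
      optionally (along λ _ → refl) (just refl) (reducing λ e → _ , sucᵇ (var-eval p) e , ≤-refl)

  record Examined {n} (γ : Vec Val n) (s : Tm n) (r : Rep (Fin σ) (Fin N))
                  (b : ∀ {m} → (Fin n → Fin m) → Handle m → Tm m) : Set where
    constructor examined
    field
      {width} : ℕ
      {env}   : Vec Val width
      {ren}   : Fin n → Fin width
      {held}  : Handle width
      extends : Along ren γ env
      handles : Handles env held r
      reduces : Reduces γ s 32 env (b ren held)

  opaque
    unfolding examine

    -- Three splits, the test for an awaited label and up to twelve tests for the code, at two steps
    -- each.
    examine-reduces : ∀ {n} {γ : Vec Val n} i (b : ∀ {m} → (Fin n → Fin m) → Handle m → Tm m) r →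
                      lookup γ i ≡ encodeRep r → Examined γ (examine i b) r b
    examine-reduces {γ = γ} i b r p with optional-reduces
        {γ = encodeExpr label (slot₀ r) ∷ encodeExpr label (slot₁ r) ∷ num (label⊥ (awaited-of r)) ∷
             _ ∷ num (toℕ (code-of r)) ∷ _ ∷ γ} 2F
        (λ f j → switch 12 (f 4F) λ f′ c → b (past f f′) (components f j f′ c)) (awaited-of r) refl
    ... | optionally {ren = f} {j} a h red
        with switch-reduces 12 (f 4F) (λ f′ c → b (past f f′) (components f j f′ c)) (code-of r) (at a 4F)
    ... | switched {ren = f′} a′ red′ = examined
      (along λ k → trans (at a′ (f (suc (suc (suc (suc (suc (suc k)))))))) (at a (suc (suc (suc (suc (suc (suc k))))))))
      (record
        { code-held    = refl
        ; awaited-held = rename-holds a′ h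
        ; slot₀-held   = trans (at a′ (f 0F)) (at a 0F)
        ; slot₁-held   = trans (at a′ (f 1F)) (at a 1F)
        })
      (split-reduces p then split-reduces refl then split-reduces refl then red then red′)

  opaque
    unfolding binary

    -- Examining both operands takes 64 steps. Templates contain no operations, so the result has at
    -- most 6 and is built in 5 · 6 + 8 steps.
    binary-eval : (_⊗_ : ∀ {L V} (s t : Form L (Expr L V) (Expr L V)) → Form L (Expr L V) (Expr L V)) →
      (∀ {m} {γ : Vec Val m} → let open AlgRel (quoted {γ = γ}) in
         ∀ {s s′ t t′} → FormRel s s′ → FormRel t t′ → FormRel (s ⊗ t) (s′ ⊗ t′)) →
      (∀ {L V} (r r′ : Rep L V) → repSize (pack (unpack r ⊗ unpack r′)) ≤ repSize r + repSize r′ + 6) →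
      ∀ {n} {γ : Vec Val n} i j {r r′ μ} → lookup γ i ≡ encodeRep r → lookup γ j ≡ encodeRep r′ →
      ∃[ t ] Eval γ (binary _⊗_ i j) μ (encodeRep (pack (unpack r ⊗ unpack r′))) μ t × t ≤ 102
    binary-eval _⊗_ rel bound i j {r} {r′} p q with examine-reduces i
        (λ f h → examine (f j) λ f′ h′ → quoteᴿ (pack (unpack (template (renameᴴ f′ h)) ⊗ unpack (template h′)))) r p
    ... | examined {ren = f} {h} a hs red with examine-reduces (f j)
        (λ f′ h′ → quoteᴿ (pack (unpack (template (renameᴴ f′ h)) ⊗ unpack (template h′)))) r′ (trans (at a j) q)
    ... | examined {ren = f′} {h′} a′ hs′ red′ =
      let t , e , b = pack-eval (rel (template-rel (rename-handles a′ hs)) (template-rel hs′))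
                                (bound (template (renameᴴ f′ h)) (template h′))
          t′ , e′ , b′ = back (red then red′) e
      in t′ , e′ , ≤-trans b′ (+-monoʳ-≤ 64 b)

    rooted-eval : ∀ {n} {γ : Vec Val n} i j {a} {r : Rep (Fin σ) (Fin N)} {μ} →
      lookup γ i ≡ num (label⊥ a) → lookup γ j ≡ encodeRep r →
      ∃[ t ] Eval γ (rooted i j) μ (encodeRep (opᴿ a r)) μ t × t ≤ 72
    rooted-eval i j {a} {r} p q with optional-reduces i
        (λ f a → examine (f j) λ f′ h → quoteᴿ (opᴿ (Maybe.map f′ a) (template h))) a p
    ... | optionally {ren = f} {b} al hs red with examine-reduces (f j)
        (λ f′ h → quoteᴿ (opᴿ (Maybe.map f′ b) (template h))) r (trans (at al j) q)
    ... | examined {ren = f′} {h} al′ hs′ red′ =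
      let t , e , b = pack-eval (AlgRel.normal-rel quoted
                                  (AlgRel.build-rel quoted (rename-holds al′ hs) (template-rel hs′) ∷ []))
                                (opᴿ-size (Maybe.map f′ b) (template h))
          t′ , e′ , b′ = back (red then red′) e
      in t′ , e′ , ≤-trans b′ (+-monoʳ-≤ 34 b)

-- Running time

nodes : ∀ {L V} → Expr L V → ℕ
nodes ε           = 1
nodes x           = 1
nodes (e₁ ∙ e₂)   = suc (nodes e₁ + nodes e₂)
nodes (e₁ ⟨ e₂ ⟩) = suc (nodes e₁ + nodes e₂)
nodes (op _ e)    = suc (nodes e)
nodes (var _)     = 1

-- An expression has at most one leaf more than binary operations, hence at most one variable more
-- than operations.
nodes-bound : ∀ {L V} (e : Expr L V) → nodes e ≤ 2 * operations e + 1
nodes-bound ε           = s≤s z≤n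
nodes-bound x           = s≤s z≤n
nodes-bound (e₁ ∙ e₂)   = ≤-trans (s≤s (+-mono-≤ (nodes-bound e₁) (nodes-bound e₂)))
                                  (≤-reflexive (lemma (operations e₁) (operations e₂)))
  where
  lemma : ∀ m n → suc (2 * m + 1 + (2 * n + 1)) ≡ 2 * suc (m + n) + 1
  lemma = solve-∀
nodes-bound (e₁ ⟨ e₂ ⟩) = ≤-trans (s≤s (+-mono-≤ (nodes-bound e₁) (nodes-bound e₂)))
                                  (≤-reflexive (lemma (operations e₁) (operations e₂)))
  where
  lemma : ∀ m n → suc (2 * m + 1 + (2 * n + 1)) ≡ 2 * suc (m + n) + 1
  lemma = solve-∀
nodes-bound (op _ e)    = ≤-trans (s≤s (nodes-bound e)) (≤-trans (n≤1+n _) (≤-reflexive (lemma (operations e))))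
  where
  lemma : ∀ m → suc (suc (2 * m + 1)) ≡ 2 * suc m + 1
  lemma = solve-∀
nodes-bound (var _)     = s≤s z≤n

store-hit : ∀ {k} (μ : Memory k) a i v → store μ a i v a i ≡ v
store-hit μ a i v with a ≟ a | i ℕ.≟ i
... | yes _ | yes _ = refl
... | no ¬p | _     = ⊥-elim (¬p refl)
... | yes _ | no ¬p = ⊥-elim (¬p refl)

store-miss : ∀ {k} (μ : Memory k) a i v b {j} → j ≢ i → store μ a i v b j ≡ μ b j
store-miss μ a i v b {j} ¬p with b ≟ a | j ℕ.≟ i
... | yes _ | yes p = ⊥-elim (¬p p)
... | yes _ | no _  = refl
... | no _  | _     = refl

sum-update : ∀ {n} (f g : Fin n → ℕ) i {w} → (∀ j → j ≢ i → f j ≡ g j) → f i + w ≡ g i →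
             sum (tabulate f) + w ≡ sum (tabulate g)
sum-update {suc n} f g zero {w} p q = begin
  f zero + sum (tabulate (f ∘ suc)) + w   ≡⟨ +-assoc (f zero) _ w ⟩
  f zero + (sum (tabulate (f ∘ suc)) + w) ≡⟨ cong (f zero +_) (+-comm _ w) ⟩
  f zero + (w + sum (tabulate (f ∘ suc))) ≡⟨ +-assoc (f zero) w _ ⟨
  f zero + w + sum (tabulate (f ∘ suc))   ≡⟨ cong₂ _+_ q (cong sum (tabulate-cong λ j → p (suc j) λ ())) ⟩
  g zero + sum (tabulate (g ∘ suc))       ∎
  where
  open ≡-Reasoning

sum-update {suc n} f g (suc i) {w} p q = trans (+-assoc (f zero) _ w) (cong₂ _+_ (p zero λ ())
  (sum-update (f ∘ suc) (g ∘ suc) i (λ j j≢i → p (suc j) λ { refl → j≢i refl }) q))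

get-eval : ∀ {n} {γ : Vec Val n} {a i k μ v} → lookup γ i ≡ num k → μ a k ≡ v → Eval γ (get a (var i)) μ v μ 2
get-eval p refl = get (var-eval p)

-- Amortised cost of the translation

module Run {σ : ℕ} (F : FSLP (Fin σ ⊎⊥)) (K : ℕ) (K≥150 : 150 ≤ K) where
  open Translation F

  Flags : Set
  Flags = Fin n → Bool

  mark-done : Flags → Fin n → Flags
  mark-done δ A B = if does (B ≟ A) then true else δ B

  mark-done-same : ∀ δ A → mark-done δ A A ≡ true
  mark-done-same δ A with A ≟ A
  ... | yes _ = refl
  ... | no ¬p = ⊥-elim (¬p refl)

  mark-done-other : ∀ δ {A B} → B ≢ A → mark-done δ A B ≡ δ B
  mark-done-other δ {A} {B} ¬p with B ≟ A
  ... | yes p = ⊥-elim (¬p p)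
  ... | no _  = refl

  flag : Bool → ℕ
  flag b = if b then 1 else 0

  record Mem (δ : Flags) (μ : Memory 4) : Set where
    field
      rhs-held     : ∀ A → μ rhs (toℕ A) ≡ encodeExpr label⊥ (ρ A)
      doubled-held : ∀ (A : Fin n) → μ doubled (toℕ A) ≡ num (toℕ A * 2)
      done-held    : ∀ A → μ done (toℕ A) ≡ num (flag (δ A))
      memo-held    : ∀ A → δ A ≡ true → μ memo (toℕ A) ≡ encodeRep (image A)

  open Mem

  pending : Fin n → Bool → ℕ
  pending A b = if b then 0 else K * nodes (ρ A)

  -- The potential of the amortised analysis: the cost of the right-hand sides
  -- that are still to be translated.
  Φ : Flags → ℕ
  Φ δ = sum (tabulate λ A → pending A (δ A))

  Φ-mark-done : ∀ δ A → δ A ≡ false → Φ (mark-done δ A) + K * nodes (ρ A) ≡ Φ δ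
  Φ-mark-done δ A p = sum-update _ _ A (λ B B≢A → cong (pending B) (mark-done-other δ B≢A))
    (trans (cong (λ b → pending A b + K * nodes (ρ A)) (mark-done-same δ A)) (sym (cong (pending A) p)))

  -- `cost` bounds the time plus the change of the potential, without subtraction; `Kept` selects
  -- the variables whose flags are promised to stay.
  record Outcome {m} (γ : Vec Val m) (s : Tm m) (v : Val) (μ : Memory 4) (δ : Flags) (c : ℕ) (Kept : Fin n → Set) : Set where
    field
      {μ′}   : Memory 4
      {δ′}   : Flags
      {time} : ℕ
      eval   : Eval γ s μ v μ′ time
      mem    : Mem δ′ μ′
      cost   : time + Φ δ′ ≤ c + Φ δ
      kept   : ∀ A → Kept A → δ′ A ≡ δ A

  open Outcome

  module _ {m} {γ : Vec Val m} {μ : Memory 4} {δ : Flags} where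

    pure : ∀ {s v c Kept} → Mem δ μ → ∃[ t ] Eval γ s μ v μ t × t ≤ c → Outcome γ s v μ δ c Kept
    pure h (t , e , p) = record { eval = e ; mem = h ; cost = +-monoˡ-≤ (Φ δ) p ; kept = λ _ _ → refl }

    prefix : ∀ {k} {γ′ : Vec Val k} {s s′ v v′ c c′ Kept} (o : Outcome γ′ s′ v′ μ δ c Kept) →
             ∃[ t ] Eval γ s μ v (μ′ o) t × t ≤ c′ + time o → Outcome γ s v μ δ (c′ + c) Kept
    prefix {c = c} {c′} o (t , e , p) = record
      { eval = e
      ; mem  = mem o
      ; cost = begin
          t + Φ (δ′ o)             ≤⟨ +-monoˡ-≤ _ p ⟩
          c′ + time o + Φ (δ′ o)   ≡⟨ +-assoc c′ _ _ ⟩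
          c′ + (time o + Φ (δ′ o)) ≤⟨ +-monoʳ-≤ c′ (cost o) ⟩
          c′ + (c + Φ δ)           ≡⟨ +-assoc c′ c _ ⟨
          c′ + c + Φ δ             ∎
      ; kept = kept o
      }
      where open ≤-Reasoning

    reduce-outcome : ∀ {k} {γ′ : Vec Val k} {s s′ v c c′ Kept} → Reduces γ s c′ γ′ s′ →
                     Outcome γ′ s′ v μ δ c Kept → Outcome γ s v μ δ (c′ + c) Kept
    reduce-outcome r o = prefix o (Reduces.back r (eval o))

    call-outcome : ∀ {s u f v t c Kept} → Eval γ s μ u μ t → Outcome (u ∷ []) (Program.body program f) v μ δ c Kept →
                   Outcome γ (call f s) v μ δ (suc t + c) Kept
    call-outcome e o = prefix o (_ , call e (eval o) , ≤-refl)

    split-outcome : ∀ {s s₁ u w v t c Kept} → Eval γ s μ (pair u w) μ t → Outcome (u ∷ w ∷ γ) s₁ v μ δ c Kept →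
                    Outcome γ (split s s₁) v μ δ (suc t + c) Kept
    split-outcome e o = prefix o (_ , split e (eval o) , ≤-refl)

    bind-outcome : ∀ {s s₁ u v c c′ Kept} (o : Outcome γ s u μ δ c Kept) →
                   Outcome (u ∷ γ) s₁ v (μ′ o) (δ′ o) c′ Kept → Outcome γ (bind s s₁) v μ δ (suc (c + c′)) Kept
    bind-outcome {c = c} {c′} o o₁ = record
      { eval = bind (eval o) (eval o₁)
      ; mem  = mem o₁
      ; cost = s≤s (begin
          time o + time o₁ + Φ (δ′ o₁)   ≡⟨ +-assoc (time o) _ _ ⟩
          time o + (time o₁ + Φ (δ′ o₁)) ≤⟨ +-monoʳ-≤ (time o) (cost o₁) ⟩
          time o + (c′ + Φ (δ′ o))       ≡⟨ rotate (time o) c′ _ ⟩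
          c′ + (time o + Φ (δ′ o))       ≤⟨ +-monoʳ-≤ c′ (cost o) ⟩
          c′ + (c + Φ δ)                 ≡⟨ +-assoc c′ c _ ⟨
          c′ + c + Φ δ                   ≡⟨ cong (_+ Φ δ) (+-comm c′ c) ⟩
          c + c′ + Φ δ                   ∎)
      ; kept = λ A p → trans (kept o₁ A p) (kept o A p)
      }
      where
      open ≤-Reasoning
      rotate : ∀ i j k → i + (j + k) ≡ j + (i + k)
      rotate = solve-∀

    weaken : ∀ {s v c c′ Kept Kept′} → c ≤ c′ → (∀ {A} → Kept′ A → Kept A) →
             Outcome γ s v μ δ c Kept → Outcome γ s v μ δ c′ Kept′
    weaken p k o = record
      { eval = eval o ; mem = mem o ; cost = ≤-trans (cost o) (+-monoˡ-≤ (Φ δ) p) ; kept = λ A q → kept o A (k q) }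

  -- The flag of A does not change while an expression below A is translated.
  Below : Fin n → Expr (Fin σ ⊎⊥) (Fin n) → Set
  Below A e = ∀ {B} → B ∈ variables e → TransClosure _occursIn_ B A

  within : ∀ {m} {γ : Vec Val m} {s v μ δ c} e e′ → (∀ {B} → B ∈ variables e → B ∈ variables e′) →
           Outcome γ s v μ δ c (λ A → Below A e) → Outcome γ s v μ δ c (λ A → Below A e′)
  within e e′ f = weaken ≤-refl λ b m → b (f m)

  enter : ∀ j p {v μ δ c Kept} →
          (∀ {m} {γ : Vec Val m} (r : Fin 3 → Fin m) → lookup γ (r 1F) ≡ p → Outcome γ (branch r j) v μ δ c Kept) →
          Outcome (pair (num (toℕ j)) p ∷ []) transformBody v μ δ (12 + c) Kept
  enter j p f with switch-reduces 5 {γ = num (toℕ j) ∷ p ∷ pair (num (toℕ j)) p ∷ []} 0F branch j refl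
  ... | switched {ren = r} a red = reduce-outcome (split-reduces refl then red) (f r (Along.at a 1F))

  atom-term : Tm 2
  atom-term = split (get memo (var 1F)) (split (var 1F)
      (bind (get doubled (var 5F))
      (cons (var 3F) (cons (var 1F) (cons (cons (lit 5) (var 0F)) (cons (lit 5) (succ (var 0F))))))))

  -- Here computed and semantic shapes meet: the memo holds what translating `ρ A` gave, whereas
  -- `atom` takes its shape from the value.
  atom-value : ∀ A → pair (num (toℕ (code-of (image A)))) (pair (num (label⊥ (awaited-of (image A))))
                       (pair (pair (num 5) (num (toℕ A * 2))) (pair (num 5) (num (suc (toℕ A * 2)))))) ≡ encodeRep (atom A)
  atom-value A = eq (code≡ (image-realises A)) (awaited≡ (image-realises A)) (sym (toℕ-even A)) (sym (toℕ-odd A))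
    where
    eq : ∀ {c c′ j j′ k k′ l l′} → c ≡ c′ → j ≡ j′ → k ≡ k′ → l ≡ l′ →
         pair (num (toℕ {13} c)) (pair (num (label⊥ {σ} j)) (pair (pair (num 5) (num k)) (pair (num 5) (num l)))) ≡
         pair (num (toℕ c′)) (pair (num (label⊥ j′)) (pair (pair (num 5) (num k′)) (pair (num 5) (num l′))))
    eq refl refl refl refl = refl

  atom-eval : ∀ {A w δ μ} → Mem δ μ → δ A ≡ true →
              ∃[ t ] Eval (w ∷ num (toℕ A) ∷ []) atom-term μ (encodeRep (atom A)) μ t × t ≤ 20
  atom-eval {A} {w} {δ} {μ} h p = _ ,
    ≡.subst (λ v → Eval (w ∷ num (toℕ A) ∷ []) atom-term μ v μ 20) (atom-value A)
      (split (get-eval refl (memo-held h A p)) (split var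
        (bind (get-eval refl (doubled-held h A))
          (cons var (cons var (cons (cons lit var) (cons lit (succ var)))))))) ,
    ≤-refl

  mark-mem : ∀ {δ μ} A → Mem δ μ →
             Mem (mark-done δ A) (store (store μ memo (toℕ A) (encodeRep (image A))) done (toℕ A) (num 1))
  mark-mem {δ} {μ} A h = record
    { rhs-held     = rhs-held h
    ; doubled-held = doubled-held h
    ; done-held    = flags
    ; memo-held    = memos
    }
    where
    μ₁ = store μ memo (toℕ A) (encodeRep (image A))
    flags : ∀ B → store μ₁ done (toℕ A) (num 1) done (toℕ B) ≡ num (flag (mark-done δ A B))
    flags B with B ≟ A
    ... | yes refl = store-hit μ₁ done (toℕ A) (num 1)
    ... | no B≢A   = trans (store-miss μ₁ done (toℕ A) (num 1) done (B≢A ∘ toℕ-injective)) (done-held h B)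
    memos : ∀ B → mark-done δ A B ≡ true → μ₁ memo (toℕ B) ≡ encodeRep (image B)
    memos B p with B ≟ A
    ... | yes refl = store-hit μ memo (toℕ A) _
    ... | no B≢A   = trans (store-miss μ memo (toℕ A) _ memo (B≢A ∘ toℕ-injective)) (memo-held h B p)

  unit-cost : ∀ {c} → c ≤ 150 → c ≤ K * 1
  unit-cost p = ≤-trans p (≤-trans K≥150 (≤-reflexive (sym (*-identityʳ K))))

  step-cost : ∀ {c} m → c ≤ 150 → c + K * m ≤ K * suc m
  step-cost m p = ≤-trans (+-monoˡ-≤ (K * m) (≤-trans p K≥150)) (≤-reflexive (sym (*-suc K m)))

  -- The dearest kind of node: 12 steps to branch on the tag, 102 for the rule, 8 for the split,
  -- calls and bindings, 122 in all.
  binary-cost : ∀ m n → 12 + (2 + suc (2 + K * m + suc (2 + K * n + 102))) ≤ K * suc (m + n)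
  binary-cost m n = ≤-trans
    (≤-reflexive (trans (lemma (K * m) (K * n)) (cong (122 +_) (sym (*-distribˡ-+ K m n)))))
    (step-cost {122} (m + n) (m≤m+n 122 28))
    where
    lemma : ∀ p q → 12 + (2 + suc (2 + p + suc (2 + q + 102))) ≡ 122 + (p + q)
    lemma = solve-∀

  rooted-cost : ∀ m → 12 + (2 + suc (2 + K * m + 72)) ≤ K * suc m
  rooted-cost m = ≤-trans (≤-reflexive (lemma (K * m))) (step-cost {89} m (m≤m+n 89 61))
    where
    lemma : ∀ p → 12 + (2 + suc (2 + p + 72)) ≡ 89 + p
    lemma = solve-∀

  -- Only the nodes of `e` itself are charged; right-hand sides translated on the way are paid from
  -- the potential.
  transform-outcome : ∀ {e v} → ρ ⊢ e ⇓ v → ∀ {δ μ} → Mem δ μ →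
    Outcome (encodeExpr label⊥ e ∷ []) transformBody (encodeRep (translate atom e)) μ δ (K * nodes e) (λ A → Below A e)

  -- A constant suffices: on a first visit, the price of `ρ A` is the drop of the potential when `A`
  -- is marked.
  visit-outcome : ∀ {A v} → ρ ⊢ ρ A ⇓ v → ∀ {δ μ} → Mem δ μ →
    Σ[ o ∈ Outcome (num (toℕ A) ∷ []) visitBody (encodeRep (atom A)) μ δ 50 (λ B → Below B (var A)) ] δ′ o A ≡ true

  transform-outcome ε h = weaken (unit-cost (m≤m+n 30 120)) id
    (enter 0F _ λ r p → pure h (pack-eval {σ = σ} {N = n * 2} {s = ∅} {∅} {2} Relations.∅ ≤-refl))
  transform-outcome x h = weaken (unit-cost (m≤m+n 30 120)) id
    (enter 1F _ λ r p → pure h (pack-eval {σ = σ} {N = n * 2} {s = X} {X} {2} Relations.X ≤-refl))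
  transform-outcome (_∙_ {e₁} {e₂} d₁ d₂ _) h = weaken (binary-cost (nodes e₁) (nodes e₂)) id
    (enter 2F _ λ r p →
      let o₁ = call-outcome {f = transform} var (within e₁ (e₁ ∙ e₂) ∈-++⁺ˡ (transform-outcome d₁ h))
          o₂ = call-outcome {f = transform} var (within e₂ (e₁ ∙ e₂) (∈-++⁺ʳ (variables e₁)) (transform-outcome d₂ (mem o₁)))
      in reduce-outcome (split-reduces p) (bind-outcome o₁ (bind-outcome o₂
           (pure (mem o₂) (binary-eval _⊙_ (AlgRel.⊙-rel quoted) ∙ᴿ-size 1F 0F {translate atom e₁} {translate atom e₂} refl refl)))))
  transform-outcome (_⟨_⟩ {e₁} {e₂} d₁ d₂ _) h = weaken (binary-cost (nodes e₁) (nodes e₂)) id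
    (enter 3F _ λ r p →
      let o₁ = call-outcome {f = transform} var (within e₁ (e₁ ⟨ e₂ ⟩) ∈-++⁺ˡ (transform-outcome d₁ h))
          o₂ = call-outcome {f = transform} var (within e₂ (e₁ ⟨ e₂ ⟩) (∈-++⁺ʳ (variables e₁)) (transform-outcome d₂ (mem o₁)))
      in reduce-outcome (split-reduces p) (bind-outcome o₁ (bind-outcome o₂
           (pure (mem o₂) (binary-eval E.vertical (AlgRel.vertical-rel quoted) ⟨⟩ᴿ-size 1F 0F {translate atom e₁} {translate atom e₂} refl refl)))))
  transform-outcome (op {a} {e} d) h = weaken (rooted-cost (nodes e)) id
    (enter 4F _ λ r p →
      let o = call-outcome {f = transform} var (within e (op a e) id (transform-outcome d h))
      in reduce-outcome (split-reduces p) (bind-outcome o (pure (mem o) (rooted-eval 1F 0F {a} {translate atom e} refl refl))))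
  transform-outcome (var d) h = weaken (unit-cost (m≤m+n 64 86)) id
    (enter 5F _ λ r p → call-outcome {f = visit} (var-eval p) (proj₁ (visit-outcome d h)))

  visit-outcome {A} d {δ} {μ} h = visit-by (δ A) refl
    where
    visit-by : ∀ b → δ A ≡ b →
      Σ[ o ∈ Outcome (num (toℕ A) ∷ []) visitBody (encodeRep (atom A)) μ δ 50 (λ B → Below B (var A)) ] δ′ o A ≡ true
    visit-by true p = weaken (m≤m+n 25 25) id (bind-outcome o (pure h (atom-eval h p))) , p
      where
      o : Outcome _ _ (num 0) μ δ 4 (λ B → Below B (var A))
      o = pure h (_ , sucᵇ (get-eval refl (trans (done-held h A) (cong (num ∘ flag) p))) lit , ≤-refl)
    visit-by false p = weaken (m≤m+n 35 15) id (bind-outcome o (pure (mem o) (atom-eval (mem o) (mark-done-same (δ′ o₁) A)))) ,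
                       mark-done-same (δ′ o₁) A
      where
      o₁ = transform-outcome d h
      -- The variables of `ρ A` lie strictly below `A`, so translating them leaves the potential of
      -- `A` unspent.
      unmarked : δ′ o₁ A ≡ false
      unmarked = trans (kept o₁ A (λ m → [ m ])) p
      distinct : ∀ {B} → Below B (var A) → B ≢ A
      distinct b refl = acyclic A (b (here refl))
      o : Outcome (num (toℕ A) ∷ []) _ (num 1) μ δ 14 (λ B → Below B (var A))
      o = record
        { eval = zeroᵇ (get-eval refl (trans (done-held h A) (cong (num ∘ flag) p)))
                   (bind (call (get-eval refl (rhs-held h A)) (eval o₁)) (bind (set var var) (set var lit)))
        ; mem  = mark-mem A (mem o₁)
        -- The price of `ρ A` is added on both sides, which completes the potential after marking to
        -- the one before.
        ; cost = +-cancelʳ-≤ (K * nodes (ρ A)) _ _ (begin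
            suc (2 + suc (3 + time o₁ + 7)) + Φ (mark-done (δ′ o₁) A) + K * nodes (ρ A)
              ≡⟨ regroup (time o₁) _ _ ⟩
            14 + (time o₁ + (Φ (mark-done (δ′ o₁) A) + K * nodes (ρ A)))
              ≡⟨ cong (λ k → 14 + (time o₁ + k)) (Φ-mark-done (δ′ o₁) A unmarked) ⟩
            14 + (time o₁ + Φ (δ′ o₁))
              ≤⟨ +-monoʳ-≤ 14 (cost o₁) ⟩
            14 + (K * nodes (ρ A) + Φ δ)
              ≡⟨ cong (14 +_) (+-comm (K * nodes (ρ A)) (Φ δ)) ⟩
            14 + (Φ δ + K * nodes (ρ A))
              ≡⟨ +-assoc 14 (Φ δ) _ ⟨
            14 + Φ δ + K * nodes (ρ A) ∎)
        ; kept = λ B b → trans (mark-done-other (δ′ o₁) (distinct b)) (kept o₁ B (λ m → m ∷ b (here refl)))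
        }
        where
        open ≤-Reasoning
        regroup : ∀ t i j → suc (2 + suc (3 + t + 7)) + i + j ≡ 14 + (t + (i + j))
        regroup = solve-∀

-- Loading the input

encodeList : ∀ {k} → (Fin k → Val) → Val
encodeList g = foldr pair (num 0) (tabulate g)

-- Entries below `i` stem from earlier rounds and must survive; `done` must stay blank, because 0
-- means unvisited.
record Loaded {k} (i : ℕ) (g : Fin k → Val) (μ μ′ : Memory 4) : Set where
  field
    rhs-loaded     : ∀ j → μ′ rhs (toℕ j + i) ≡ g j
    doubled-loaded : ∀ (j : Fin k) → μ′ doubled (toℕ j + i) ≡ num ((toℕ j + i) * 2)
    rhs-old        : ∀ {l} → l < i → μ′ rhs l ≡ μ rhs l
    doubled-old    : ∀ {l} → l < i → μ′ doubled l ≡ μ doubled l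
    done-old       : ∀ l → μ′ done l ≡ μ done l

open Loaded

load-eval : ∀ k i (g : Fin k → Val) μ →
  ∃[ μ′ ] ∃[ t ] Eval (pair (num k) (pair (num i) (pair (num (i * 2)) (encodeList g))) ∷ []) loadBody μ
                      (num ((k + i) * 2)) μ′ t ×
                 t ≤ 29 * k + 9 × Loaded i g μ μ′
load-eval zero    i g μ = μ , _ , split var (zeroᵇ var (split var (split var var))) , ≤-refl , record
  { rhs-loaded = λ () ; doubled-loaded = λ () ; rhs-old = λ _ → refl ; doubled-old = λ _ → refl ; done-old = λ _ → refl }
load-eval (suc k) i g μ with load-eval k (suc i) (g ∘ suc) (store (store μ rhs i (g zero)) doubled i (num (i * 2)))
... | μ′ , t , e , b , h = μ′ , _ ,
  split var (sucᵇ var (split var (split var (split var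
    (bind (set var var) (bind (set var var)
      (call (cons var (cons (succ var) (cons (succ (succ var)) var)))
        (≡.subst (λ l → Eval (argument ∷ []) loadBody μ₁ (num (l * 2)) μ′ t) (+-suc k i) e)))))))) ,
  ≤-trans (+-monoʳ-≤ 29 b) (≤-reflexive (lemma k)) ,
  record
    { rhs-loaded     = λ { zero    → trans (rhs-old h ≤-refl) (store-hit μ rhs i (g zero))
                         ; (suc j) → trans (cong (μ′ rhs) (sym (+-suc (toℕ j) i))) (rhs-loaded h j) }
    ; doubled-loaded = λ { zero    → trans (doubled-old h ≤-refl) (store-hit _ doubled i (num (i * 2)))
                         ; (suc j) → ≡.subst (λ l → μ′ doubled l ≡ num (l * 2)) (+-suc (toℕ j) i) (doubled-loaded h j) }
    ; rhs-old        = λ l<i → trans (rhs-old h (m≤n⇒m≤1+n l<i)) (store-miss μ rhs i (g zero) rhs (<⇒≢ l<i))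
    ; doubled-old    = λ l<i → trans (doubled-old h (m≤n⇒m≤1+n l<i)) (store-miss _ doubled i (num (i * 2)) doubled (<⇒≢ l<i))
    ; done-old       = done-old h
    }
  where
  μ₁ = store (store μ rhs i (g zero)) doubled i (num (i * 2))
  argument = pair (num k) (pair (num (suc i)) (pair (num (suc i * 2)) (encodeList (g ∘ suc))))
  lemma : ∀ k → 29 + (29 * k + 9) ≡ 29 * suc k + 9
  lemma = solve-∀

-- The complete run

module Whole {σ : ℕ} (F : FSLP (Fin σ ⊎⊥)) (K : ℕ) (K≥150 : 150 ≤ K) where
  open Translation F
  open Run F K K≥150
  open Outcome
  open Mem

  visit-at : ∀ {A i δ μ} → toℕ A ≡ i → Mem δ μ →
    Σ[ o ∈ Outcome (num i ∷ []) visitBody (encodeRep (atom A)) μ δ 50 (λ _ → ⊥) ] δ′ o A ≡ true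
  visit-at {A} refl h with proj₂ (defined A)
  ... | var d = let o , p = visit-outcome d h in weaken ≤-refl ⊥-elim o , p

  -- `f` enumerates the variables from index `i` on, so the recursion can run on `k` while `Fin n`
  -- stays fixed.
  emit-outcome : ∀ k i (f : Fin k → Fin n) → (∀ j → toℕ (f j) ≡ toℕ j + i) → ∀ {δ μ} → Mem δ μ →
    Outcome (pair (num k) (num i) ∷ []) emitBody
      (encodeList (encodeExpr label ∘ interleave (slot₀ ∘ image ∘ f) (slot₁ ∘ image ∘ f))) μ δ (75 * k + 5) (λ _ → ⊥)
  emit-outcome zero    i f p h = pure h (_ , split var (zeroᵇ var lit) , ≤-refl)
  emit-outcome (suc k) i f p h = weaken (≤-reflexive (lemma k)) id
    (split-outcome var (reduce-outcome suc-reduces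
      (bind-outcome o (split-outcome (get-eval refl (trans (cong (μ′ o₁ memo) (sym (p zero))) (memo-held (mem o₁) (f zero) (proj₂ v))))
        (split-outcome var (split-outcome var
          (bind-outcome o′ (pure (mem o′) (_ , cons var (cons var var) , ≤-refl)))))))))
    where
    v  = visit-at (p zero) h
    o₁ = proj₁ v
    o  = call-outcome {f = visit} var o₁
    o′ = call-outcome {f = emit} (cons var (succ var))
           (emit-outcome k (suc i) (f ∘ suc) (λ j → trans (p (suc j)) (sym (+-suc (toℕ j) i))) (mem o₁))
    suc-reduces : ∀ {m} {γ : Vec Val m} {s s₁ k} → Reduces (num (suc k) ∷ γ) (ifzero (var 0F) s s₁) 2 (num k ∷ num (suc k) ∷ γ) s₁
    suc-reduces = reducing λ e → _ , sucᵇ var e , ≤-refl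
    lemma : ∀ k → 2 + (2 + suc (52 + (3 + (2 + (2 + suc (5 + (75 * k + 5) + 5)))))) ≡ 75 * suc k + 5
    lemma = solve-∀

  unvisited : Flags
  unvisited _ = false

  loaded-mem : ∀ {μ} → Loaded 0 (encodeExpr label⊥ ∘ ρ) blank μ → Mem unvisited μ
  loaded-mem {μ} h = record
    { rhs-held     = λ A → trans (cong (μ rhs) (sym (+-identityʳ (toℕ A)))) (rhs-loaded h A)
    ; doubled-held = λ A → ≡.subst (λ l → μ doubled l ≡ num (l * 2)) (+-identityʳ (toℕ A)) (doubled-loaded h A)
    ; done-held    = λ A → done-old h (toℕ A)
    ; memo-held    = λ _ ()
    }

  -- The initial potential pays for all right-hand sides; the summand `n` is the one extra leaf of
  -- each.
  Φ-unvisited : Φ unvisited ≤ K * (2 * size F + n)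
  Φ-unvisited = ≤-trans (sum-bound K _ (nodes ∘ ρ) (λ _ → ≤-refl)) (*-monoʳ-≤ K (total (λ A → nodes-bound (ρ A))))
    where
    total : ∀ {m} {f g : Fin m → ℕ} → (∀ i → f i ≤ 2 * g i + 1) → sum (tabulate f) ≤ 2 * sum (tabulate g) + m
    total {zero}  p = z≤n
    total {suc m} {f} {g} p = ≤-trans (+-mono-≤ (p zero) (total (p ∘ suc))) (≤-reflexive (lemma (g zero) _ m))
      where
      lemma : ∀ a b m → 2 * a + 1 + (2 * b + m) ≡ 2 * (a + b) + suc m
      lemma = solve-∀

  run : ∀ {f} (p : ⟦ F ⟧ ≡ fcns f ∷ []) →
        ∃[ t ] (program runs encode label⊥ F ↦ encode label (result p) in-steps t) ×
               t ≤ 38 + 104 * n + K * (2 * size F + n)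
  run p with load-eval n 0 (encodeExpr label⊥ ∘ ρ) blank
  ... | μ , t , e , b , h = _ , (_ ,
    split var (split var
      (bind (call (cons var (cons lit (cons lit var))) e)
      (bind (call (cons var lit) (eval o))
      (cons (var-eval (cong (λ k → num (k * 2)) (+-identityʳ n)))
        (cons (get-eval refl (trans (doubled-held (mem o) start) (cong num (sym (toℕ-even start))))) var)))))) ,
    bound
    where
    o = emit-outcome n 0 id (λ j → sym (+-identityʳ (toℕ j))) (loaded-mem h)
    bound : _ ≤ 38 + 104 * n + K * (2 * size F + n)
    bound = begin
      _ ≡⟨ lemma₁ t (time o) ⟩
      24 + (t + time o)
        ≤⟨ +-monoʳ-≤ 24 (+-mono-≤ b (≤-trans (m≤m+n (time o) _) (≤-trans (cost o) (+-monoʳ-≤ (75 * n + 5) Φ-unvisited)))) ⟩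
      24 + (29 * n + 9 + (75 * n + 5 + K * (2 * size F + n)))
        ≡⟨ lemma₂ n _ ⟩
      38 + 104 * n + K * (2 * size F + n) ∎
      where
      open ≤-Reasoning
      lemma₁ : ∀ t u → suc (suc (suc (suc (suc (suc (7 + t) + suc (suc (3 + u) + 6)))))) ≡ 24 + (t + u)
      lemma₁ = solve-∀
      lemma₂ : ∀ n k → 24 + (29 * n + 9 + (75 * n + 5 + k)) ≡ 38 + 104 * n + k
      lemma₂ = solve-∀

-- As `1 ≤ n`, the constant 38 is charged to the variables: 38 + 104 + 150 = 292 for each, and 2 ·
-- 150 = 300 for each operation.
run-bound : ∀ {n} s → 1 ≤ n → 38 + 104 * n + 150 * (2 * s + n) ≤ 300 * (n + s)
run-bound {n} s p = begin
  38 + 104 * n + 150 * (2 * s + n)      ≤⟨ +-monoˡ-≤ _ (+-monoˡ-≤ (104 * n) (*-monoʳ-≤ 38 p)) ⟩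
  38 * n + 104 * n + 150 * (2 * s + n)  ≤⟨ m≤m+n _ (8 * n) ⟩
  38 * n + 104 * n + 150 * (2 * s + n) + 8 * n ≡⟨ lemma n s ⟩
  300 * (n + s) ∎
  where
  open ≤-Reasoning
  lemma : ∀ n s → 38 * n + 104 * n + 150 * (2 * s + n) + 8 * n ≡ 300 * (n + s)
  lemma = solve-∀

proposition5 : ∃[ P ] ∃[ c ]
    ((σ : ℕ) (f : 𝓕₀ (Fin σ)) (G : FSLP (Fin σ ⊎⊥) ⊎ TSLP (Fin σ ⊎⊥)) →
    let F = asFSLP G in
    ⟦ F ⟧ ≡ fcns f ∷ [] →
    ∃[ F′ ] ∃[ t ]
    (P runs encode label⊥ F ↦ encode (label {σ}) F′ in-steps t) ×
    t ≤ c * inputLength F ×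
    ⟦ F′ ⟧ ≡ f ×
    size F′ ≤ c * size F)
proposition5 = program , 300 , λ σ f G p →
  let F = asFSLP G
      t , r , b = Whole.run F 150 ≤-refl p
  in Translation.result F p , t , r ,
     ≤-trans b (run-bound (size F) (≤-trans (s≤s z≤n) (toℕ<n (FSLP.start F)))) ,
     refl ,
     ≤-trans (Translation.size-result F p) (*-monoˡ-≤ (size F) {6} {300} (m≤m+n 6 294))
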